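{- Fix $z \in (0,\tfrac14)$ and two domino cells $D_{\mathrm h}$ and $D_{\mathrm v}$, each with its set of non-leaves as distinguished set, $D_{\mathrm h}$ meeting the connecting cell in value and $D_{\mathrm v}$ meeting it in position. Then for every $c \ge 1$, all sums running over the connecting cells $C$ with exactly $c$ skew components, $$\sum_C z^{|C|} N_{\mathrm h}(C; D_{\mathrm h})\, N_{\mathrm v}(C; D_{\mathrm v}) \;\ge\; \frac{\bigl(\sum_C z^{|C|} N_{\mathrm h}(C; D_{\mathrm h})\bigr)\bigl(\sum_C z^{|C|} N_{\mathrm v}(C; D_{\mathrm v})\bigr)}{Q(z)^{c}} ,$$ where $Q(z) = \tfrac12\bigl(1-\sqrt{1-4z}\bigr)$.
   Context: A connecting cell $C$ is a permutation in a fixed one of the two classes $\operatorname{Av}(213)$, $\operatorname{Av}(132)$; $|C|$ is its number of points. Every permutation is uniquely a skew sum $c_1 \ominus \cdots \ominus c_r$ of skew indecomposable permutations, its skew components; they occupy consecutive position intervals and consecutive value intervals, earlier components holding larger values. The function $Q(z)$ is the generating function, by number of points, of the nonempty skew indecomposable permutations in $\operatorname{Av}(213)$ (equivalently, in $\operatorname{Av}(132)$). A domino cell $D$ is a finite permutation avoiding $213$ or avoiding $132$. Its leaves are its right-to-left maxima if it is a cell of the $\operatorname{Av}(213)$ kind, and its left-to-right minima if it is a cell of the $\operatorname{Av}(132)$ kind; its other points are non-leaves. Placements. Let $C$ have skew components of sizes $\mathbf w = (w_1,\dots,w_c)$, read along the axis (position or value) on which $D$ and $C$ interleave, and let $D$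 be a domino cell with a distinguished set $S$ of its points. A placement of $D$ against $C$ is a weakly increasing map from the points of $D$, totally ordered along that axis, to $\{0,1,\dots,|C|\}$ (the image of a point counts how many points of $C$ precede it along the axis). It is admissible if every point of $S$ is sent into $G(\mathbf w) = \{0,\sigma_1,\dots,\sigma_c\}$, where $\sigma_i = w_1+\cdots+w_i$. $N(C;D)$ is the number of admissible placements. $N_{\mathrm v}(C;D_{\mathrm v})$ is this count with position as the axis (points of $D_{\mathrm v}$ ordered by position, components of $C$ read left to right); $N_{\mathrm h}(C;D_{\mathrm h})$ is this count with value as the axis (points of $D_{\mathrm h}$ ordered by value, components of $C$ read in increasing value, i.e. in the reverse of the position order). In both, $S$ is the set of non-leaves. -}

module Defs where

open import Data.Fin as Fin using (Fin; toℕ)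
import Data.Fin.Properties as Fin
open import Data.List using (List; []; _∷_; map; filter; foldr; length; upTo;
  allFin; zipWith; drop; reverse; scanl; cartesianProductWith)
open import Data.List.Membership.DecPropositional using (_∈?_)
open import Data.List.Membership.Propositional using (_∈_)
open import Data.Nat as ℕ using (ℕ; zero; suc)
import Data.Nat.Properties as ℕ
open import Data.Integer using (+_)
open import Data.Product using (∃-syntax; _×_; _,_)
open import Data.Rational as ℚ using (ℚ; 0ℚ; 1ℚ; ½; _+_; _-_; -_; _*_; _≤_; _<_;
  _⊔_; ∣_∣; 1/_; positive; nonNegative)
open import Data.Rational.Properties as ℚ using (module ≤-Reasoning)
open import Data.Vec using (Vec; []; _∷_; lookup)
open import Level using (0ℓ)
open import Relation.Binary.PropositionalEquality using (_≡_; refl; sym; trans; cong; cong₂; subst)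
open import Relation.Nullary using (¬_; ¬?; _×-dec_; _→-dec_; dec⇒maybe)
open import Relation.Unary using (Decidable)
open import Tactic.RingSolver using (solve-∀)
open import Tactic.RingSolver.Core.AlmostCommutativeRing using
  (AlmostCommutativeRing; fromCommutativeRing)

Eventually : (ℕ → Set) → Set
Eventually P = ∃[ N ] ∀ n → N ℕ.≤ n → P n

Cauchy : (ℕ → ℚ) → Set
Cauchy x = ∀ ε → 0ℚ < ε →
  ∃[ N ] ∀ m n → N ℕ.≤ m → N ℕ.≤ n → ∣ x m - x n ∣ ≤ ε

-- Equality of reals is _≃ℝ_ below, not _≡_.
record ℝ : Set where
  constructor mkℝ
  field
    seq    : ℕ → ℚ
    cauchy : Cauchy seq

open ℝ public

infix 4 _≤ℝ_ _<ℝ_ _≥ℝ_ _≃ℝ_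

_≤ℝ_ : ℝ → ℝ → Set
x ≤ℝ y = ∀ ε → 0ℚ < ε → Eventually (λ n → seq x n ≤ seq y n + ε)

_≥ℝ_ : ℝ → ℝ → Set
x ≥ℝ y = y ≤ℝ x

_<ℝ_ : ℝ → ℝ → Set
x <ℝ y = ∃[ δ ] 0ℚ < δ × Eventually (λ n → seq x n + δ ≤ seq y n)

_≃ℝ_ : ℝ → ℝ → Set
x ≃ℝ y = x ≤ℝ y × y ≤ℝ x

module CauchyLemmas where
  half-pos : ∀ {ε} → 0ℚ < ε → 0ℚ < ½ * ε
  half-pos {ε} 0<ε = subst (_< ½ * ε) (ℚ.*-zeroʳ ½) (ℚ.*-monoʳ-<-pos ½ 0<ε)

  halves : ∀ ε → ½ * ε + ½ * ε ≡ ε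
  halves ε = trans (sym (ℚ.*-distribʳ-+ ε ½ ½)) (ℚ.*-identityˡ ε)

  *-pos : ∀ p q → 0ℚ < p → 0ℚ < q → 0ℚ < p * q
  *-pos p q 0<p 0<q =
    subst (_< p * q) (ℚ.*-zeroʳ p) (ℚ.*-monoʳ-<-pos p {{positive 0<p}} 0<q)

  *-mono-≤-nonNeg : ∀ p q r s → 0ℚ ≤ p → 0ℚ ≤ s → p ≤ q → r ≤ s → p * r ≤ q * s
  *-mono-≤-nonNeg p q r s 0≤p 0≤s p≤q r≤s = ℚ.≤-trans
    (ℚ.*-monoˡ-≤-nonNeg p {{nonNegative 0≤p}} r≤s)
    (ℚ.*-monoʳ-≤-nonNeg s {{nonNegative 0≤s}} p≤q)

  inv : ∀ p → 0ℚ < p → ℚ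
  inv p 0<p = (1/ p) {{ℚ.pos⇒nonZero p {{positive 0<p}}}}

  *-inv : ∀ p 0<p → p * inv p 0<p ≡ 1ℚ
  *-inv p 0<p = ℚ.*-inverseʳ p {{ℚ.pos⇒nonZero p {{positive 0<p}}}}

  inv-pos : ∀ p 0<p → 0ℚ < inv p 0<p
  inv-pos p 0<p = ℚ.positive⁻¹ _ {{ℚ.1/pos⇒pos p {{positive 0<p}}}}

  ring : AlmostCommutativeRing 0ℓ 0ℓ
  ring = fromCommutativeRing ℚ.+-*-commutativeRing (λ p → dec⇒maybe (0ℚ ℚ.≟ p))

  +-diff : ∀ a b c d → (a + b) - (c + d) ≡ (a - c) + (b - d)
  +-diff = solve-∀ ring

  neg-diff : ∀ a b → - a - - b ≡ - (a - b)
  neg-diff = solve-∀ ring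

  *-diff : ∀ a b c d → a * b - c * d ≡ a * (b - d) + d * (a - c)
  *-diff = solve-∀ ring

  inv-diff : ∀ u v a b → (u - v) * (a * b) ≡ (a * u) * b - (b * v) * a
  inv-diff = solve-∀ ring

  insert : ∀ a b → a ≡ (a - b) + b
  insert = solve-∀ ring

  swap-* : ∀ b e i → b * (e * i) ≡ e * (b * i)
  swap-* = solve-∀ ring

  +-cauchy : ∀ x y → Cauchy x → Cauchy y → Cauchy (λ n → x n + y n)
  +-cauchy x y cx cy ε 0<ε with cx (½ * ε) (half-pos 0<ε) | cy (½ * ε) (half-pos 0<ε)
  ... | M , xM | N , yN = M ℕ.⊔ N , λ m n m≥ n≥ → begin
    ∣ (x m + y m) - (x n + y n) ∣
      ≡⟨ cong ∣_∣ (+-diff (x m) (y m) (x n) (y n)) ⟩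
    ∣ (x m - x n) + (y m - y n) ∣
      ≤⟨ ℚ.∣p+q∣≤∣p∣+∣q∣ (x m - x n) (y m - y n) ⟩
    ∣ x m - x n ∣ + ∣ y m - y n ∣
      ≤⟨ ℚ.+-mono-≤ (xM m n (ℕ.m⊔n≤o⇒m≤o M N m≥) (ℕ.m⊔n≤o⇒m≤o M N n≥))
                    (yN m n (ℕ.m⊔n≤o⇒n≤o M N m≥) (ℕ.m⊔n≤o⇒n≤o M N n≥)) ⟩
    ½ * ε + ½ * ε
      ≡⟨ halves ε ⟩
    ε ∎
    where open ≤-Reasoning

  neg-cauchy : ∀ x → Cauchy x → Cauchy (λ n → - x n)
  neg-cauchy x cx ε 0<ε with cx ε 0<ε
  ... | N , xN = N , λ m n m≥ n≥ → begin
    ∣ - x m - - x n ∣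
      ≡⟨ cong ∣_∣ (neg-diff (x m) (x n)) ⟩
    ∣ - (x m - x n) ∣
      ≡⟨ ℚ.∣-p∣≡∣p∣ (x m - x n) ⟩
    ∣ x m - x n ∣
      ≤⟨ xN m n m≥ n≥ ⟩
    ε ∎
    where open ≤-Reasoning

  bounded : ∀ x → Cauchy x → ∃[ B ] 0ℚ < B × Eventually (λ n → ∣ x n ∣ ≤ B)
  bounded x cx with cx 1ℚ (ℚ.positive⁻¹ 1ℚ)
  ... | N , xN = 1ℚ + ∣ x N ∣
               , ℚ.+-mono-<-≤ (ℚ.positive⁻¹ 1ℚ) (ℚ.0≤∣p∣ (x N))
               , N , λ n n≥ → begin
    ∣ x n ∣
      ≡⟨ cong ∣_∣ (insert (x n) (x N)) ⟩
    ∣ (x n - x N) + x N ∣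
      ≤⟨ ℚ.∣p+q∣≤∣p∣+∣q∣ (x n - x N) (x N) ⟩
    ∣ x n - x N ∣ + ∣ x N ∣
      ≤⟨ ℚ.+-monoˡ-≤ ∣ x N ∣ (xN n N n≥ ℕ.≤-refl) ⟩
    1ℚ + ∣ x N ∣ ∎
    where open ≤-Reasoning

  abstract
    share : (ε B : ℚ) → 0ℚ < B → ℚ
    share ε B 0<B = (½ * ε) * inv B 0<B

    share-pos : ∀ {ε B} → 0ℚ < ε → (0<B : 0ℚ < B) → 0ℚ < share ε B 0<B
    share-pos {ε} {B} 0<ε 0<B = *-pos (½ * ε) (inv B 0<B) (half-pos 0<ε) (inv-pos B 0<B)

    *-share : ∀ ε B (0<B : 0ℚ < B) → B * share ε B 0<B ≡ ½ * ε
    *-share ε B 0<B = trans (swap-* B (½ * ε) (inv B 0<B))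
      (trans (cong ((½ * ε) *_) (*-inv B 0<B)) (ℚ.*-identityʳ (½ * ε)))

  ∣pq∣≤½ε : ∀ ε B (0<ε : 0ℚ < ε) (0<B : 0ℚ < B) p q →
    ∣ p ∣ ≤ B → ∣ q ∣ ≤ share ε B 0<B → ∣ p * q ∣ ≤ ½ * ε
  ∣pq∣≤½ε ε B 0<ε 0<B p q p≤ q≤ = begin
    ∣ p * q ∣          ≡⟨ ℚ.∣p*q∣≡∣p∣*∣q∣ p q ⟩
    ∣ p ∣ * ∣ q ∣      ≤⟨ *-mono-≤-nonNeg (∣ p ∣) B (∣ q ∣) (share ε B 0<B) (ℚ.0≤∣p∣ p)
                           (ℚ.<⇒≤ (share-pos 0<ε 0<B)) p≤ q≤ ⟩
    B * share ε B 0<B  ≡⟨ *-share ε B 0<B ⟩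
    ½ * ε              ∎
    where open ≤-Reasoning

  *-close : ∀ ε a b c d → ∣ a * (b - d) ∣ ≤ ½ * ε → ∣ d * (a - c) ∣ ≤ ½ * ε →
    ∣ a * b - c * d ∣ ≤ ε
  *-close ε a b c d p q = begin
    ∣ a * b - c * d ∣                  ≡⟨ cong ∣_∣ (*-diff a b c d) ⟩
    ∣ a * (b - d) + d * (a - c) ∣      ≤⟨ ℚ.∣p+q∣≤∣p∣+∣q∣ (a * (b - d)) (d * (a - c)) ⟩
    ∣ a * (b - d) ∣ + ∣ d * (a - c) ∣  ≤⟨ ℚ.+-mono-≤ p q ⟩
    ½ * ε + ½ * ε                      ≡⟨ halves ε ⟩
    ε                                  ∎
    where open ≤-Reasoning

  *-cauchy : ∀ x y → Cauchy x → Cauchy y → Cauchy (λ n → x n * y n)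
  *-cauchy x y cx cy ε 0<ε =
    let B , 0<B , M , xB = bounded x cx
        C , 0<C , N , yC = bounded y cy
        K , yK = cy (share ε B 0<B) (share-pos 0<ε 0<B)
        L , xL = cx (share ε C 0<C) (share-pos 0<ε 0<C)
    in (M ℕ.⊔ N) ℕ.⊔ (K ℕ.⊔ L) , λ m n m≥ n≥ →
    let m≥MN = ℕ.m⊔n≤o⇒m≤o (M ℕ.⊔ N) (K ℕ.⊔ L) m≥
        n≥MN = ℕ.m⊔n≤o⇒m≤o (M ℕ.⊔ N) (K ℕ.⊔ L) n≥
        m≥KL = ℕ.m⊔n≤o⇒n≤o (M ℕ.⊔ N) (K ℕ.⊔ L) m≥
        n≥KL = ℕ.m⊔n≤o⇒n≤o (M ℕ.⊔ N) (K ℕ.⊔ L) n≥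
    in *-close ε (x m) (y m) (x n) (y n)
         (∣pq∣≤½ε ε B 0<ε 0<B (x m) (y m - y n) (xB m (ℕ.m⊔n≤o⇒m≤o M N m≥MN))
           (yK m n (ℕ.m⊔n≤o⇒m≤o K L m≥KL) (ℕ.m⊔n≤o⇒m≤o K L n≥KL)))
         (∣pq∣≤½ε ε C 0<ε 0<C (y n) (x m - x n) (yC n (ℕ.m⊔n≤o⇒n≤o M N n≥MN))
           (xL m n (ℕ.m⊔n≤o⇒n≤o K L m≥KL) (ℕ.m⊔n≤o⇒n≤o K L n≥KL)))

  ⊔-pos : ∀ {δ} p → 0ℚ < δ → 0ℚ < p ⊔ δ
  ⊔-pos {δ} p 0<δ = ℚ.<-≤-trans 0<δ (ℚ.p≤q⊔p p δ)

  inv-cauchy : ∀ x {δ} (0<δ : 0ℚ < δ) → Cauchy x → Eventually (λ n → δ ≤ x n) →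
    Cauchy (λ n → inv (x n ⊔ δ) (⊔-pos (x n) 0<δ))
  inv-cauchy x {δ} 0<δ cx (M , δ≤x) ε 0<ε
    with cx (ε * (δ * δ)) (*-pos ε (δ * δ) 0<ε (*-pos δ δ 0<δ 0<δ))
  ... | N , xN = M ℕ.⊔ N , λ m n m≥ n≥ →
    inv-close (x m ⊔ δ) (x n ⊔ δ) (⊔-pos (x m) 0<δ) (⊔-pos (x n) 0<δ)
      (ℚ.p≤q⊔p (x m) δ) (ℚ.p≤q⊔p (x n) δ)
      (subst (λ t → ∣ t ∣ ≤ ε * (δ * δ))
        (cong₂ _-_ (sym (ℚ.p≥q⇒p⊔q≡p (δ≤x n (ℕ.m⊔n≤o⇒m≤o M N n≥))))
                   (sym (ℚ.p≥q⇒p⊔q≡p (δ≤x m (ℕ.m⊔n≤o⇒m≤o M N m≥)))))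
        (xN n m (ℕ.m⊔n≤o⇒n≤o M N n≥) (ℕ.m⊔n≤o⇒n≤o M N m≥)))
    where
    open ≤-Reasoning
    inv-close : ∀ a b 0<a 0<b → δ ≤ a → δ ≤ b → ∣ b - a ∣ ≤ ε * (δ * δ) →
      ∣ inv a 0<a - inv b 0<b ∣ ≤ ε
    inv-close a b 0<a 0<b δ≤a δ≤b close = let u = inv a 0<a ; v = inv b 0<b in
      ℚ.*-cancelʳ-≤-pos {∣ u - v ∣} {ε} (a * b) {{positive (*-pos a b 0<a 0<b)}} (begin
      ∣ u - v ∣ * (a * b)
        ≡⟨ cong (∣ u - v ∣ *_) (sym (ℚ.0≤p⇒∣p∣≡p (ℚ.<⇒≤ (*-pos a b 0<a 0<b)))) ⟩
      ∣ u - v ∣ * ∣ a * b ∣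
        ≡⟨ sym (ℚ.∣p*q∣≡∣p∣*∣q∣ (u - v) (a * b)) ⟩
      ∣ (u - v) * (a * b) ∣
        ≡⟨ cong ∣_∣ (inv-diff u v a b) ⟩
      ∣ (a * u) * b - (b * v) * a ∣
        ≡⟨ cong ∣_∣ (cong₂ (λ s t → s * b - t * a) (*-inv a 0<a) (*-inv b 0<b)) ⟩
      ∣ 1ℚ * b - 1ℚ * a ∣
        ≡⟨ cong ∣_∣ (cong₂ _-_ (ℚ.*-identityˡ b) (ℚ.*-identityˡ a)) ⟩
      ∣ b - a ∣
        ≤⟨ close ⟩
      ε * (δ * δ)
        ≤⟨ ℚ.*-monoˡ-≤-nonNeg ε {{nonNegative (ℚ.<⇒≤ 0<ε)}}
             (*-mono-≤-nonNeg δ a δ b (ℚ.<⇒≤ 0<δ) (ℚ.<⇒≤ 0<b) δ≤a δ≤b) ⟩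
      ε * (a * b) ∎)

open CauchyLemmas

infixl 6 _+ℝ_ _-ℝ_
infixl 7 _*ℝ_ _/ℝ_[_]
infixr 8 _^ℝ_

fromℚ : ℚ → ℝ
fromℚ q = mkℝ (λ _ → q) λ ε 0<ε → 0 , λ _ _ _ _ →
  subst (_≤ ε) (sym (cong ∣_∣ (ℚ.+-inverseʳ q))) (ℚ.<⇒≤ 0<ε)

fromℕ : ℕ → ℝ
fromℕ n = fromℚ (+ n ℚ./ 1)

_+ℝ_ _-ℝ_ _*ℝ_ : ℝ → ℝ → ℝ
x +ℝ y = mkℝ (λ n → seq x n + seq y n) (+-cauchy (seq x) (seq y) (cauchy x) (cauchy y))
x -ℝ y = mkℝ (λ n → seq x n - seq y n)
  (+-cauchy (seq x) (λ n → - seq y n) (cauchy x) (neg-cauchy (seq y) (cauchy y)))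
x *ℝ y = mkℝ (λ n → seq x n * seq y n) (*-cauchy (seq x) (seq y) (cauchy x) (cauchy y))

_^ℝ_ : ℝ → ℕ → ℝ
x ^ℝ zero  = fromℕ 1
x ^ℝ suc n = x *ℝ x ^ℝ n

-- A witness of 0 < x supplies a rational δ > 0 below almost all seq x n, so
-- replacing seq x n by seq x n ⊔ δ changes only finitely many terms and makes
-- every term invertible.
recip : ∀ x → fromℕ 0 <ℝ x → ℝ
recip x (δ , 0<δ , M , δ≤x) = mkℝ
  (λ n → inv (seq x n ⊔ δ) (⊔-pos (seq x n) 0<δ))
  (inv-cauchy (seq x) 0<δ (cauchy x)
    (M , λ n n≥ → subst (_≤ seq x n) (ℚ.+-identityˡ δ) (δ≤x n n≥)))

_/ℝ_[_] : ℝ → ∀ y → fromℕ 0 <ℝ y → ℝ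
x /ℝ y [ 0<y ] = x *ℝ recip y 0<y

_IsSqrtOf_ : ℝ → ℝ → Set
s IsSqrtOf x = fromℕ 0 ≤ℝ s × s *ℝ s ≃ℝ x

sumℝ : List ℝ → ℝ
sumℝ = foldr _+ℝ_ (fromℕ 0)

partialSum : (ℕ → ℝ) → ℕ → ℝ
partialSum a zero    = fromℕ 0
partialSum a (suc n) = partialSum a n +ℝ a n

HasSum : (ℕ → ℝ) → ℝ → Set
HasSum a L = ∀ ε → 0ℚ < ε → Eventually λ n →
  L -ℝ fromℚ ε ≤ℝ partialSum a n × partialSum a n ≤ℝ L +ℝ fromℚ ε

-- One-line notation, with positions and values counted from 0.
Word : ℕ → Set
Word n = Vec (Fin n) n

IsPermutation : ∀ {n} → Word n → Set
IsPermutation π = ∀ i j → lookup π i ≡ lookup π j → i ≡ j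

isPermutation? : ∀ {n} → Decidable (IsPermutation {n})
isPermutation? π = Fin.all? λ i → Fin.all? λ j →
  (lookup π i Fin.≟ lookup π j) →-dec (i Fin.≟ j)

data Class : Set where
  av213 av132 : Class

Avoids : Class → ∀ {n} → Word n → Set
Avoids av213 π = ∀ i j k → i Fin.< j → j Fin.< k →
  ¬ (lookup π j Fin.< lookup π i × lookup π i Fin.< lookup π k)
Avoids av132 π = ∀ i j k → i Fin.< j → j Fin.< k →
  ¬ (lookup π i Fin.< lookup π k × lookup π k Fin.< lookup π j)

avoids? : ∀ κ {n} → Decidable (Avoids κ {n})
avoids? av213 π = Fin.all? λ i → Fin.all? λ j → Fin.all? λ k →
  (i Fin.<? j) →-dec (j Fin.<? k) →-dec
  ¬? ((lookup π j Fin.<? lookup π i) ×-dec (lookup π i Fin.<? lookup π k))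
avoids? av132 π = Fin.all? λ i → Fin.all? λ j → Fin.all? λ k →
  (i Fin.<? j) →-dec (j Fin.<? k) →-dec
  ¬? ((lookup π i Fin.<? lookup π k) ×-dec (lookup π k Fin.<? lookup π j))

-- π = σ ⊖ τ with σ on the first p positions; p = 0 and p = n always qualify.
SkewCut : ∀ {n} → Word n → ℕ → Set
SkewCut π p = ∀ i j → toℕ i ℕ.< p → p ℕ.≤ toℕ j → lookup π j Fin.< lookup π i

skewCut? : ∀ {n} (π : Word n) → Decidable (SkewCut π)
skewCut? π p = Fin.all? λ i → Fin.all? λ j →
  (toℕ i ℕ.<? p) →-dec (p ℕ.≤? toℕ j) →-dec (lookup π j Fin.<? lookup π i)

skewCuts : ∀ {n} → Word n → List ℕ
skewCuts {n} π = filter (skewCut? π) (upTo (suc n))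

-- The skew components are the blocks between consecutive cuts.
componentSizes : ∀ {n} → Word n → List ℕ
componentSizes π = zipWith ℕ._∸_ (drop 1 (skewCuts π)) (skewCuts π)

allVecs : ∀ k m → List (Vec (Fin k) m)
allVecs k zero    = [] ∷ []
allVecs k (suc m) = cartesianProductWith _∷_ (allFin k) (allVecs k m)

IsConnectingCell : Class → (c : ℕ) → ∀ {n} → Word n → Set
IsConnectingCell κ c π =
  IsPermutation π × Avoids κ π × length (componentSizes π) ≡ c

isConnectingCell? : ∀ κ c {n} → Decidable (IsConnectingCell κ c {n})
isConnectingCell? κ c π =
  isPermutation? π ×-dec avoids? κ π ×-dec (length (componentSizes π) ℕ.≟ c)

connectingCells : Class → (c n : ℕ) → List (Word n)
connectingCells κ c n = filter (isConnectingCell? κ c) (allVecs n n)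

record DominoCell : Set where
  field
    kind          : Class
    size          : ℕ
    perm          : Word size
    isPermutation : IsPermutation perm
    avoids        : Avoids kind perm

open DominoCell public

IsLeaf : Class → ∀ {n} → Word n → Fin n → Set
IsLeaf av213 π i = ∀ j → i Fin.< j → lookup π j Fin.< lookup π i
IsLeaf av132 π i = ∀ j → j Fin.< i → lookup π i Fin.< lookup π j

isLeaf? : ∀ κ {n} (π : Word n) → Decidable (IsLeaf κ π)
isLeaf? av213 π i = Fin.all? λ j → (i Fin.<? j) →-dec (lookup π j Fin.<? lookup π i)
isLeaf? av132 π i = Fin.all? λ j → (j Fin.<? i) →-dec (lookup π i Fin.<? lookup π j)

Leaf : (D : DominoCell) → Fin (size D) → Set
Leaf D = IsLeaf (kind D) (perm D)

leaf? : ∀ D → Decidable (Leaf D)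
leaf? D = isLeaf? (kind D) (perm D)

data Axis : Set where
  position value : Axis

coordinate : Axis → (D : DominoCell) → Fin (size D) → Fin (size D)
coordinate position D i = i
coordinate value    D i = lookup (perm D) i

-- Components further right hold smaller values.
sizesAlong : Axis → ∀ {n} → Word n → List ℕ
sizesAlong position C = componentSizes C
sizesAlong value    C = reverse (componentSizes C)

gates : List ℕ → List ℕ
gates = scanl ℕ._+_ 0

-- Points of D are indexed by position whichever axis is used.
IsAdmissiblePlacement : Axis → ∀ {n} (C : Word n) (D : DominoCell) →
  Vec (Fin (suc n)) (size D) → Set
IsAdmissiblePlacement a C D f =
  (∀ i j → coordinate a D i Fin.≤ coordinate a D j → lookup f i Fin.≤ lookup f j) ×
  (∀ i → ¬ Leaf D i → toℕ (lookup f i) ∈ gates (sizesAlong a C))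

isAdmissiblePlacement? : ∀ a {n} (C : Word n) D → Decidable (IsAdmissiblePlacement a C D)
isAdmissiblePlacement? a C D f =
  (Fin.all? λ i → Fin.all? λ j →
    (coordinate a D i Fin.≤? coordinate a D j) →-dec (lookup f i Fin.≤? lookup f j))
  ×-dec
  (Fin.all? λ i → ¬? (leaf? D i) →-dec
    _∈?_ ℕ._≟_ (toℕ (lookup f i)) (gates (sizesAlong a C)))

N : Axis → ∀ {n} → Word n → DominoCell → ℕ
N a {n} C D =
  length (filter (isAdmissiblePlacement? a C D) (allVecs (suc n) (size D)))

Nₕ Nᵥ : ∀ {n} → Word n → DominoCell → ℕ
Nₕ = N value
Nᵥ = N position

-- The sum of z^|C| F(C) over the connecting cells C with c components, as a
-- series whose nth term collects the finitely many cells with |C| = n.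
cellSeries : Class → (c : ℕ) → ℝ → (∀ {n} → Word n → ℕ) → ℕ → ℝ
cellSeries κ c z F n =
  sumℝ (map (λ C → z ^ℝ n *ℝ fromℕ (F C)) (connectingCells κ c n))

{-# OPTIONS --safe #-}
module Submission where

-- The number of placements depends only on the vector w of component sizes, and
-- it is increasing in w, since stretching the components embeds {0, …, |C|} so
-- that gates go to gates.  Splitting off the first skew component identifies the
-- cells with c components with c-tuples of indecomposables, so weighting a cell
-- by z^|C| is a product measure on w of total mass Q(z)^c, and the claim is
-- Harris' correlation inequality.
--
-- Truncated to sizes below L, Harris' inequality involves the sum W of z^|σ| over
-- indecomposables σ in place of Q.  An indecomposable is a member of the class
-- with one point added, and a nonempty member is an indecomposable ⊖ a member,
-- so W is at most the L-th iterate of q ↦ z + q² from 0, an iteration that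
-- converges geometrically to Q.  Taking these iterates at the n-th approximation
-- of z as the n-th approximation of Q, and truncating the left-hand series at
-- c n + 1 instead of n, makes the inequality hold exactly between approximations.

-- Harris' inequality has W^c on its larger side, so an upper bound for W is what is wanted, and the
-- combinatorial comparisons can be one-sided: each is an injection between index sets with
-- nonnegative terms.
--
-- The sums in the theorem have to be produced as Cauchy sequences of rationals. The estimates are
-- therefore made at a rational x, with error bounds common to all late approximations x of z, which
-- lie in an interval [δ, 1/4 - η]. This uniformity permits a diagonal: the truncation and the
-- approximation of z advance together, and every choice of truncation g n ≥ n represents the sum.
-- That freedom absorbs the mismatch between truncating by total size and truncating each component,
-- since components below n bound the size only by c n.
--
-- The point 1/4 enters twice. Below it the map q ↦ x + q² has slope 2 q < 1 up to its smaller fixed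
-- point. At x = 1/4 itself the iterates still stay below 1/2, which limits the number of cells of
-- size n to 4^n; the number of placements is only polynomial in n, so the series converge.

open import Defs
open CauchyLemmas using
  (ring; halves; half-pos; inv; inv-pos; *-inv; *-pos; *-mono-≤-nonNeg; ⊔-pos)
open import Data.Empty using (⊥-elim)
open import Data.Fin as Fin using (Fin; zero; suc; toℕ; _↑ˡ_; _↑ʳ_; inject₁)
import Data.Fin.Properties as Fin
open import Data.Fin.Relation.Unary.Top using (view; ‵fromℕ; ‵inject₁)
open import Data.Integer as ℤ using (ℤ)
import Data.Integer.Properties as ℤ
open import Data.List as List using
  (List; []; _∷_; _++_; length; filter; upTo; applyUpTo; zipWith; drop; scanl; reverse; cartesianProduct)
import Data.List.Properties as List
open import Data.List.Membership.DecPropositional using (_∈?_)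
open import Data.List.Membership.Propositional using (_∈_)
open import Data.List.Membership.Propositional.Properties
open import Data.List.Relation.Binary.Permutation.Propositional as Perm using
  (_↭_; ↭-trans; ↭-prep; ↭-refl)
open import Data.List.Relation.Binary.Permutation.Propositional.Properties using
  (shift; ↭-length; ↭-reverse)
open import Data.List.Relation.Binary.Pointwise as Pointwise using (Pointwise; []; _∷_)
open import Data.List.Relation.Unary.All as All using (All)
open import Data.List.Relation.Unary.AllPairs using ([]; _∷_)
open import Data.List.Relation.Unary.Any using (here; there)
open import Data.List.Relation.Unary.Unique.Propositional using (Unique)
import Data.List.Relation.Unary.Unique.Propositional.Properties as Unique
open import Data.Maybe using (Maybe; just; nothing)
open import Data.Nat as ℕ using (ℕ; zero; suc)
open import Data.Nat.ListAction using (sum)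
open import Data.Nat.ListAction.Properties using (sum-↭)
import Data.Nat.Properties as ℕ
open import Data.Product using (Σ-syntax; ∃-syntax; _×_; _,_; proj₁; proj₂)
open import Data.Rational as ℚ using
  (ℚ; mkℚ; toℚᵘ; 0ℚ; 1ℚ; ½; _+_; _-_; -_; _*_; _≤_; _<_; _⊔_; ∣_∣; nonNegative)
import Data.Rational.Properties as ℚ
open import Data.Rational.Unnormalised as ℚᵘ using (mkℚᵘ; *≡*; *≤*)
import Data.Rational.Unnormalised.Properties as ℚᵘ
open import Data.Sum using (inj₁; inj₂)
open import Data.Vec as Vec using (Vec; []; _∷_; _∷ʳ_; lookup; tabulate)
import Data.Vec.Properties as Vec
open import Function using (_∘_; id)
open import Relation.Binary.Definitions using (tri<; tri≈; tri>)
open import Relation.Binary.PropositionalEquality using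
  (_≡_; _≢_; refl; sym; trans; cong; cong₂; subst; subst₂; module ≡-Reasoning)
open import Relation.Nullary using (¬_; ¬?; yes; no; _×-dec_; _→-dec_)
open import Relation.Unary using (Decidable)
open import Tactic.RingSolver using (solve-∀)

-- Skew sums

val : ∀ {n} → Word n → Fin n → ℕ
val π i = toℕ (lookup π i)

perm-val : ∀ {n} {π : Word n} → IsPermutation π → ∀ i j → val π i ≡ val π j → i ≡ j
perm-val perm i j eq = perm i j (Fin.toℕ-injective eq)

lookup-ext : ∀ {a} {A : Set a} {n} {u v : Vec A n} → (∀ i → lookup u i ≡ lookup v i) → u ≡ v
lookup-ext {u = u} {v} eq =
  trans (sym (Vec.tabulate∘lookup u)) (trans (Vec.tabulate-cong eq) (Vec.tabulate∘lookup v))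

val-ext : ∀ {n} {π ρ : Word n} → (∀ i → val π i ≡ val ρ i) → π ≡ ρ
val-ext eq = lookup-ext (λ i → Fin.toℕ-injective (eq i))

data Split (k m : ℕ) : Fin (k ℕ.+ m) → Set where
  left  : (i : Fin k) → Split k m (i ↑ˡ m)
  right : (j : Fin m) → Split k m (k ↑ʳ j)

split : ∀ k m (i : Fin (k ℕ.+ m)) → Split k m i
split zero    m i       = right i
split (suc k) m zero    = left zero
split (suc k) m (suc i) with split k m i
... | left i′  = left (suc i′)
... | right j  = right j

infixl 6 _⊖_
_⊖_ : ∀ {k m} → Word k → Word m → Word (k ℕ.+ m)
_⊖_ {k} {m} σ τ =
  Vec.map (λ v → Fin.cast (ℕ.+-comm m k) (m ↑ʳ v)) σ Vec.++
  Vec.map (λ v → Fin.cast (ℕ.+-comm m k) (v ↑ˡ k)) τ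

val-⊖ˡ : ∀ {k m} (σ : Word k) (τ : Word m) i → val (σ ⊖ τ) (i ↑ˡ m) ≡ m ℕ.+ val σ i
val-⊖ˡ {k} {m} σ τ i = begin
  val (σ ⊖ τ) (i ↑ˡ m)
    ≡⟨ cong toℕ (trans (Vec.lookup-++ˡ (Vec.map _ σ) _ i) (Vec.lookup-map i _ σ)) ⟩
  toℕ (Fin.cast (ℕ.+-comm m k) (m ↑ʳ lookup σ i))
    ≡⟨ Fin.toℕ-cast (ℕ.+-comm m k) _ ⟩
  toℕ (m ↑ʳ lookup σ i)
    ≡⟨ Fin.toℕ-↑ʳ m (lookup σ i) ⟩
  m ℕ.+ val σ i ∎
  where open ≡-Reasoning

val-⊖ʳ : ∀ {k m} (σ : Word k) (τ : Word m) j → val (σ ⊖ τ) (k ↑ʳ j) ≡ val τ j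
val-⊖ʳ {k} {m} σ τ j = begin
  val (σ ⊖ τ) (k ↑ʳ j)
    ≡⟨ cong toℕ (trans (Vec.lookup-++ʳ (Vec.map _ σ) _ j) (Vec.lookup-map j _ τ)) ⟩
  toℕ (Fin.cast (ℕ.+-comm m k) (lookup τ j ↑ˡ k))
    ≡⟨ Fin.toℕ-cast (ℕ.+-comm m k) _ ⟩
  toℕ (lookup τ j ↑ˡ k)
    ≡⟨ Fin.toℕ-↑ˡ (lookup τ j) k ⟩
  val τ j ∎
  where open ≡-Reasoning

⊖-separated : ∀ {k m} (σ : Word k) (τ : Word m) i j →
  val (σ ⊖ τ) (k ↑ʳ j) ℕ.< val (σ ⊖ τ) (i ↑ˡ m)
⊖-separated {k} {m} σ τ i j = subst₂ ℕ._<_ (sym (val-⊖ʳ σ τ j)) (sym (val-⊖ˡ σ τ i))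
  (ℕ.<-≤-trans (Fin.toℕ<n (lookup τ j)) (ℕ.m≤m+n m (val σ i)))

left<right : ∀ k m (i : Fin k) (j : Fin m) → (i ↑ˡ m) Fin.< (k ↑ʳ j)
left<right k m i j = subst₂ ℕ._<_ (sym (Fin.toℕ-↑ˡ i m)) (sym (Fin.toℕ-↑ʳ k j))
  (ℕ.<-≤-trans (Fin.toℕ<n i) (ℕ.m≤m+n k (toℕ j)))

⊖-injectiveˡ : ∀ {k m} (σ σ′ : Word k) (τ τ′ : Word m) → σ ⊖ τ ≡ σ′ ⊖ τ′ → σ ≡ σ′
⊖-injectiveˡ {m = m} σ σ′ τ τ′ eq = val-ext λ i → ℕ.+-cancelˡ-≡ m _ _
  (trans (sym (val-⊖ˡ σ τ i)) (trans (cong (λ π → val π (i ↑ˡ m)) eq) (val-⊖ˡ σ′ τ′ i)))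

⊖-injectiveʳ : ∀ {k m} (σ σ′ : Word k) (τ τ′ : Word m) → σ ⊖ τ ≡ σ′ ⊖ τ′ → τ ≡ τ′
⊖-injectiveʳ {k} σ σ′ τ τ′ eq = val-ext λ j →
  trans (sym (val-⊖ʳ σ τ j)) (trans (cong (λ π → val π (k ↑ʳ j)) eq) (val-⊖ʳ σ′ τ′ j))

-- τ sits in π up to a shift of positions and a shift of values. Both summands of a skew sum and the
-- word inside `extend` are of this shape, so being a permutation and avoiding κ are inherited by
-- one argument.
record _Embeds_ {n m} (π : Word n) (τ : Word m) : Set where
  field
    embed       : Fin m → Fin n
    posShift    : ℕ
    valShift    : ℕ
    embed-pos   : ∀ i → toℕ (embed i) ≡ posShift ℕ.+ toℕ i
    embed-val   : ∀ i → val π (embed i) ≡ valShift ℕ.+ val τ i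

  embed-injective : ∀ i j → embed i ≡ embed j → i ≡ j
  embed-injective i j eq = Fin.toℕ-injective (ℕ.+-cancelˡ-≡ posShift _ _
    (trans (sym (embed-pos i)) (trans (cong toℕ eq) (embed-pos j))))

  embed-< : ∀ {i j} → i Fin.< j → embed i Fin.< embed j
  embed-< {i} {j} i<j = subst₂ ℕ._<_ (sym (embed-pos i)) (sym (embed-pos j))
    (ℕ.+-monoʳ-< posShift i<j)

  embed-<⁻ : ∀ {i j} → embed i Fin.< embed j → i Fin.< j
  embed-<⁻ {i} {j} lt = ℕ.+-cancelˡ-< posShift _ _
    (subst₂ ℕ._<_ (embed-pos i) (embed-pos j) lt)

  embed-val-< : ∀ {i j} → val τ i ℕ.< val τ j → val π (embed i) ℕ.< val π (embed j)
  embed-val-< {i} {j} lt = subst₂ ℕ._<_ (sym (embed-val i)) (sym (embed-val j))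
    (ℕ.+-monoʳ-< valShift lt)

  embed-val-<⁻ : ∀ {i j} → val π (embed i) ℕ.< val π (embed j) → val τ i ℕ.< val τ j
  embed-val-<⁻ {i} {j} lt = ℕ.+-cancelˡ-< valShift _ _
    (subst₂ ℕ._<_ (embed-val i) (embed-val j) lt)

  embed-perm : IsPermutation π → IsPermutation τ
  embed-perm perm i j eq = embed-injective i j (perm-val {π = π} perm _ _
    (trans (embed-val i) (trans (cong (λ v → valShift ℕ.+ toℕ v) eq) (sym (embed-val j)))))

  embed-perm⁻ : IsPermutation τ → ∀ i j → val π (embed i) ≡ val π (embed j) → embed i ≡ embed j
  embed-perm⁻ perm i j eq = cong embed (perm-val {π = τ} perm i j (ℕ.+-cancelˡ-≡ valShift _ _
    (trans (sym (embed-val i)) (trans eq (embed-val j)))))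

  embed-avoids : ∀ κ → Avoids κ π → Avoids κ τ
  embed-avoids av213 av i j k i<j j<k (p , q) =
    av (embed i) (embed j) (embed k) (embed-< i<j) (embed-< j<k) (embed-val-< p , embed-val-< q)
  embed-avoids av132 av i j k i<j j<k (p , q) =
    av (embed i) (embed j) (embed k) (embed-< i<j) (embed-< j<k) (embed-val-< p , embed-val-< q)

open _Embeds_ public

⊖-embedsˡ : ∀ {k m} (σ : Word k) (τ : Word m) → (σ ⊖ τ) Embeds σ
⊖-embedsˡ {k} {m} σ τ = record
  { embed = _↑ˡ m ; posShift = 0 ; valShift = m
  ; embed-pos = λ i → Fin.toℕ-↑ˡ i m ; embed-val = val-⊖ˡ σ τ }

⊖-embedsʳ : ∀ {k m} (σ : Word k) (τ : Word m) → (σ ⊖ τ) Embeds τ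
⊖-embedsʳ {k} {m} σ τ = record
  { embed = k ↑ʳ_ ; posShift = k ; valShift = 0
  ; embed-pos = Fin.toℕ-↑ʳ k ; embed-val = val-⊖ʳ σ τ }

⊖-perm : ∀ {k m} (σ : Word k) (τ : Word m) →
  IsPermutation σ → IsPermutation τ → IsPermutation (σ ⊖ τ)
⊖-perm {k} {m} σ τ permσ permτ i j eq with split k m i | split k m j
... | left i′  | left j′  = embed-perm⁻ (⊖-embedsˡ σ τ) permσ i′ j′ (cong toℕ eq)
... | right i′ | right j′ = embed-perm⁻ (⊖-embedsʳ σ τ) permτ i′ j′ (cong toℕ eq)
... | left i′  | right j′ = ⊥-elim (ℕ.<-irrefl (cong toℕ (sym eq)) (⊖-separated σ τ i′ j′))
... | right i′ | left j′  = ⊥-elim (ℕ.<-irrefl (cong toℕ eq) (⊖-separated σ τ j′ i′))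

-- Both patterns have their first entry below their last, whereas a skew sum puts everything on the
-- left above everything on the right. So an occurrence has its two ends, and hence its middle, in
-- one summand.
⊖-avoids : ∀ κ {k m} (σ : Word k) (τ : Word m) → Avoids κ σ → Avoids κ τ → Avoids κ (σ ⊖ τ)
⊖-avoids κ {k} {m} σ τ avσ avτ = go κ avσ avτ
  where
  E = ⊖-embedsˡ σ τ
  F = ⊖-embedsʳ σ τ
  wrong-way : ∀ i j → ¬ (k ↑ʳ j) Fin.< (i ↑ˡ m)
  wrong-way i j lt = ℕ.<-asym lt (left<right k m i j)
  go : ∀ κ → Avoids κ σ → Avoids κ τ → Avoids κ (σ ⊖ τ)
  go av213 avσ avτ a b c a<b b<c (p , q) with split k m a | split k m b | split k m c
  ... | left i  | left j  | left l  =
    avσ i j l (embed-<⁻ E a<b) (embed-<⁻ E b<c) (embed-val-<⁻ E p , embed-val-<⁻ E q)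
  ... | right i | right j | right l =
    avτ i j l (embed-<⁻ F a<b) (embed-<⁻ F b<c) (embed-val-<⁻ F p , embed-val-<⁻ F q)
  ... | left i  | _       | right l = ℕ.<-asym q (⊖-separated σ τ i l)
  ... | left i  | right j | left l  = wrong-way l j b<c
  ... | right i | left j  | _       = wrong-way j i a<b
  ... | right i | right j | left l  = wrong-way l j b<c
  go av132 avσ avτ a b c a<b b<c (p , q) with split k m a | split k m b | split k m c
  ... | left i  | left j  | left l  =
    avσ i j l (embed-<⁻ E a<b) (embed-<⁻ E b<c) (embed-val-<⁻ E p , embed-val-<⁻ E q)
  ... | right i | right j | right l =
    avτ i j l (embed-<⁻ F a<b) (embed-<⁻ F b<c) (embed-val-<⁻ F p , embed-val-<⁻ F q)
  ... | left i  | _       | right l = ℕ.<-asym p (⊖-separated σ τ i l)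
  ... | left i  | right j | left l  = wrong-way l j b<c
  ... | right i | left j  | _       = wrong-way j i a<b
  ... | right i | right j | left l  = wrong-way l j b<c

injection⇒≤ : ∀ {a b} (f : Fin a → ℕ) → (∀ i j → f i ≡ f j → i ≡ j) → (∀ i → f i ℕ.< b) → a ℕ.≤ b
injection⇒≤ f inj f<b = Fin.injective⇒≤ {f = λ i → Fin.fromℕ< (f<b i)} λ {i} {j} eq →
  inj i j (trans (sym (Fin.toℕ-fromℕ< (f<b i))) (trans (cong toℕ eq) (Fin.toℕ-fromℕ< (f<b j))))

-- The m values to the right of a cut at k are all smaller than the k values to
-- its left, so by counting they are exactly 0, …, m - 1.
module _ {k m} (π : Word (k ℕ.+ m)) (perm : IsPermutation π) (cut : SkewCut π k) where

  cut-separates : ∀ (i : Fin k) (j : Fin m) → val π (k ↑ʳ j) ℕ.< val π (i ↑ˡ m)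
  cut-separates i j = cut (i ↑ˡ m) (k ↑ʳ j)
    (subst (ℕ._< k) (sym (Fin.toℕ-↑ˡ i m)) (Fin.toℕ<n i))
    (subst (k ℕ.≤_) (sym (Fin.toℕ-↑ʳ k j)) (ℕ.m≤m+n k (toℕ j)))

  left-large : ∀ i → m ℕ.≤ val π (i ↑ˡ m)
  left-large i = injection⇒≤ (λ j → val π (k ↑ʳ j))
    (λ j j′ eq → Fin.↑ʳ-injective k j j′ (perm-val {π = π} perm _ _ eq)) (cut-separates i)

  right-small : ∀ j → val π (k ↑ʳ j) ℕ.< m
  right-small j = ℕ.+-cancelˡ-≤ k _ _ (begin
    k ℕ.+ suc (val π (k ↑ʳ j))
      ≤⟨ ℕ.+-monoˡ-≤ (suc (val π (k ↑ʳ j))) k≤ ⟩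
    (k ℕ.+ m ℕ.∸ suc (val π (k ↑ʳ j))) ℕ.+ suc (val π (k ↑ʳ j))
      ≡⟨ ℕ.m∸n+n≡m (Fin.toℕ<n (lookup π (k ↑ʳ j))) ⟩
    k ℕ.+ m ∎)
    where
    open ℕ.≤-Reasoning
    -- The k values on the left all exceed `val π (k ↑ʳ j)`. Lowered by one more than it, they
    -- remain distinct and fit into the room above it.
    k≤ : k ℕ.≤ k ℕ.+ m ℕ.∸ suc (val π (k ↑ʳ j))
    k≤ = injection⇒≤ (λ i → val π (i ↑ˡ m) ℕ.∸ suc (val π (k ↑ʳ j)))
      (λ i i′ eq → Fin.↑ˡ-injective m i i′ (perm-val {π = π} perm _ _
        (ℕ.∸-cancelʳ-≡ (cut-separates i j) (cut-separates i′ j) eq)))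
      (λ i → ℕ.∸-monoˡ-< (Fin.toℕ<n (lookup π (i ↑ˡ m))) (cut-separates i j))

  ⊖-split : ∃[ σ ] ∃[ τ ] σ ⊖ τ ≡ π
  ⊖-split = σ , τ , val-ext same
    where
    σ<k : ∀ i → val π (i ↑ˡ m) ℕ.∸ m ℕ.< k
    σ<k i = subst (val π (i ↑ˡ m) ℕ.∸ m ℕ.<_) (ℕ.m+n∸n≡m k m)
      (ℕ.∸-monoˡ-< (Fin.toℕ<n (lookup π (i ↑ˡ m))) (left-large i))
    σ : Word k
    σ = tabulate λ i → Fin.fromℕ< (σ<k i)
    τ : Word m
    τ = tabulate λ j → Fin.fromℕ< (right-small j)
    same : ∀ i → val (σ ⊖ τ) i ≡ val π i
    same i with split k m i
    ... | left i′ = begin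
      val (σ ⊖ τ) (i′ ↑ˡ m)
        ≡⟨ val-⊖ˡ σ τ i′ ⟩
      m ℕ.+ val σ i′
        ≡⟨ cong (λ v → m ℕ.+ toℕ v) (Vec.lookup∘tabulate _ i′) ⟩
      m ℕ.+ toℕ (Fin.fromℕ< (σ<k i′))
        ≡⟨ cong (m ℕ.+_) (Fin.toℕ-fromℕ< (σ<k i′)) ⟩
      m ℕ.+ (val π (i′ ↑ˡ m) ℕ.∸ m)
        ≡⟨ ℕ.m+[n∸m]≡n (left-large i′) ⟩
      val π (i′ ↑ˡ m) ∎
      where open ≡-Reasoning
    ... | right j = trans (val-⊖ʳ σ τ j)
      (trans (cong toℕ (Vec.lookup∘tabulate _ j)) (Fin.toℕ-fromℕ< (right-small j)))

-- Pigeonhole: a missed value could be punched out, leaving an injection of n + 1 points into n.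
perm-surjective : ∀ {n} {π : Word n} → IsPermutation π → ∀ v → ∃[ i ] lookup π i ≡ v
perm-surjective {n} {π} perm v with Fin.any? (λ i → lookup π i Fin.≟ v)
... | yes hit = hit
... | no miss = ⊥-elim (missing π perm v miss)
  where
  missing : ∀ {n} (π : Word n) → IsPermutation π → ∀ v → ¬ (¬ (∃[ i ] lookup π i ≡ v))
  missing {suc n} π perm v miss = ℕ.1+n≰n (Fin.injective⇒≤ {f = f} λ {i} {j} eq →
    perm i j (Fin.punchOut-injective (avoid i) (avoid j) eq))
    where
    avoid : ∀ i → v ≢ lookup π i
    avoid i eq = miss (i , sym eq)
    f : Fin (suc n) → Fin n
    f i = Fin.punchOut (avoid i)

-- Skew components

module _ {k m} (σ : Word k) (τ : Word m) where

  cut-⊖ˡ : ∀ {p} → SkewCut (σ ⊖ τ) p → SkewCut σ p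
  cut-⊖ˡ {p} cut i j i<p p≤j = embed-val-<⁻ (⊖-embedsˡ σ τ) (cut (i ↑ˡ m) (j ↑ˡ m)
    (subst (ℕ._< p) (sym (Fin.toℕ-↑ˡ i m)) i<p) (subst (p ℕ.≤_) (sym (Fin.toℕ-↑ˡ j m)) p≤j))

  cut-⊖ˡ⁻ : ∀ {p} → p ℕ.≤ k → SkewCut σ p → SkewCut (σ ⊖ τ) p
  cut-⊖ˡ⁻ {p} p≤k cut i j i<p p≤j with split k m i | split k m j
  ... | left i′  | left j′  = embed-val-< (⊖-embedsˡ σ τ) (cut i′ j′
    (subst (ℕ._< p) (Fin.toℕ-↑ˡ i′ m) i<p) (subst (p ℕ.≤_) (Fin.toℕ-↑ˡ j′ m) p≤j))
  ... | left i′  | right j′ = ⊖-separated σ τ i′ j′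
  ... | right i′ | _        = ⊥-elim (ℕ.<⇒≱ i<p
    (ℕ.≤-trans p≤k (subst (k ℕ.≤_) (sym (Fin.toℕ-↑ʳ k i′)) (ℕ.m≤m+n k (toℕ i′)))))

  cut-⊖ʳ : ∀ {p} → SkewCut (σ ⊖ τ) (k ℕ.+ p) → SkewCut τ p
  cut-⊖ʳ {p} cut i j i<p p≤j = embed-val-<⁻ (⊖-embedsʳ σ τ) (cut (k ↑ʳ i) (k ↑ʳ j)
    (subst (ℕ._< k ℕ.+ p) (sym (Fin.toℕ-↑ʳ k i)) (ℕ.+-monoʳ-< k i<p))
    (subst (k ℕ.+ p ℕ.≤_) (sym (Fin.toℕ-↑ʳ k j)) (ℕ.+-monoʳ-≤ k p≤j)))

  cut-⊖ʳ⁻ : ∀ {p} → SkewCut τ p → SkewCut (σ ⊖ τ) (k ℕ.+ p)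
  cut-⊖ʳ⁻ {p} cut i j i<p p≤j with split k m i | split k m j
  ... | left i′  | left j′  = ⊥-elim (ℕ.<⇒≱ (Fin.toℕ<n j′)
    (ℕ.≤-trans (ℕ.m≤m+n k p) (subst (k ℕ.+ p ℕ.≤_) (Fin.toℕ-↑ˡ j′ m) p≤j)))
  ... | right i′ | left j′  = ⊥-elim (ℕ.<⇒≱ (Fin.toℕ<n j′)
    (ℕ.≤-trans (ℕ.m≤m+n k p) (subst (k ℕ.+ p ℕ.≤_) (Fin.toℕ-↑ˡ j′ m) p≤j)))
  ... | left i′  | right j′ = ⊖-separated σ τ i′ j′
  ... | right i′ | right j′ = embed-val-< (⊖-embedsʳ σ τ) (cut i′ j′
    (ℕ.+-cancelˡ-< k _ _ (subst (ℕ._< k ℕ.+ p) (Fin.toℕ-↑ʳ k i′) i<p))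
    (ℕ.+-cancelˡ-≤ k _ _ (subst (k ℕ.+ p ℕ.≤_) (Fin.toℕ-↑ʳ k j′) p≤j)))

cut-0 : ∀ {n} (π : Word n) → SkewCut π 0
cut-0 π i j () _

cut-n : ∀ {n} (π : Word n) → SkewCut π n
cut-n π i j _ n≤j = ⊥-elim (ℕ.<⇒≱ (Fin.toℕ<n j) n≤j)

applyUpTo-+ : ∀ {a} {A : Set a} (f : ℕ → A) m n →
  applyUpTo f (m ℕ.+ n) ≡ applyUpTo f m ++ applyUpTo (λ i → f (m ℕ.+ i)) n
applyUpTo-+ f zero    n = refl
applyUpTo-+ f (suc m) n = cong (f 0 ∷_) (applyUpTo-+ (λ i → f (suc i)) m n)

filter-cong-∈ : ∀ {a p q} {A : Set a} {P : A → Set p} {Q : A → Set q}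
  (P? : Decidable P) (Q? : Decidable Q) xs →
  (∀ {x} → x ∈ xs → P x → Q x) → (∀ {x} → x ∈ xs → Q x → P x) →
  filter P? xs ≡ filter Q? xs
filter-cong-∈ P? Q? []       to from = refl
filter-cong-∈ P? Q? (x ∷ xs) to from with P? x | Q? x
... | yes _ | yes _ = cong (x ∷_) (filter-cong-∈ P? Q? xs (to ∘ there) (from ∘ there))
... | no _  | no _  = filter-cong-∈ P? Q? xs (to ∘ there) (from ∘ there)
... | yes p | no ¬q = ⊥-elim (¬q (to (here refl) p))
... | no ¬p | yes q = ⊥-elim (¬p (from (here refl) q))

filter-map : ∀ {a b p} {A : Set a} {B : Set b} {P : B → Set p} (P? : Decidable P) (f : A → B) xs →
  filter P? (List.map f xs) ≡ List.map f (filter (P? ∘ f) xs)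
filter-map P? f []       = refl
filter-map P? f (x ∷ xs) with P? (f x)
... | yes _ = cong (f x ∷_) (filter-map P? f xs)
... | no _  = filter-map P? f xs

-- The cut at n is left out because in `σ ⊖ τ` the last cut of σ coincides with the shifted cut 0 of
-- τ and must be listed once.
starts : ∀ {n} → Word n → List ℕ
starts {n} π = filter (skewCut? π) (upTo n)

skewCuts-starts : ∀ {n} (π : Word n) → skewCuts π ≡ starts π ++ n ∷ []
skewCuts-starts {n} π = begin
  filter (skewCut? π) (upTo (suc n))
    ≡⟨ cong (filter (skewCut? π)) (sym (List.upTo-∷ʳ n)) ⟩
  filter (skewCut? π) (upTo n ++ n ∷ [])
    ≡⟨ List.filter-++ (skewCut? π) (upTo n) (n ∷ []) ⟩
  starts π ++ filter (skewCut? π) (n ∷ [])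
    ≡⟨ cong (starts π ++_) (List.filter-accept (skewCut? π) (cut-n π)) ⟩
  starts π ++ n ∷ [] ∎
  where open ≡-Reasoning

skewCuts-⊖ : ∀ {k m} (σ : Word k) (τ : Word m) →
  skewCuts (σ ⊖ τ) ≡ starts σ ++ List.map (k ℕ.+_) (skewCuts τ)
skewCuts-⊖ {k} {m} σ τ = begin
  filter (skewCut? (σ ⊖ τ)) (upTo (suc (k ℕ.+ m)))
    ≡⟨ cong (λ n → filter (skewCut? (σ ⊖ τ)) (upTo n)) (sym (ℕ.+-suc k m)) ⟩
  filter (skewCut? (σ ⊖ τ)) (upTo (k ℕ.+ suc m))
    ≡⟨ cong (filter (skewCut? (σ ⊖ τ))) (applyUpTo-+ id k (suc m)) ⟩
  filter (skewCut? (σ ⊖ τ)) (upTo k ++ applyUpTo (k ℕ.+_) (suc m))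
    ≡⟨ List.filter-++ (skewCut? (σ ⊖ τ)) (upTo k) _ ⟩
  filter (skewCut? (σ ⊖ τ)) (upTo k) ++ filter (skewCut? (σ ⊖ τ)) (applyUpTo (k ℕ.+_) (suc m))
    ≡⟨ cong₂ _++_
         (filter-cong-∈ (skewCut? (σ ⊖ τ)) (skewCut? σ) (upTo k) (λ _ → cut-⊖ˡ σ τ)
           (λ x∈ → cut-⊖ˡ⁻ σ τ (ℕ.<⇒≤ (∈-upTo⁻ x∈))))
         (trans (cong (filter (skewCut? (σ ⊖ τ))) (sym (List.map-upTo (k ℕ.+_) (suc m))))
           (trans (filter-map (skewCut? (σ ⊖ τ)) (k ℕ.+_) (upTo (suc m)))
             (cong (List.map (k ℕ.+_)) (filter-cong-∈ (skewCut? (σ ⊖ τ) ∘ (k ℕ.+_)) (skewCut? τ) (upTo (suc m))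
               (λ _ → cut-⊖ʳ σ τ) (λ _ → cut-⊖ʳ⁻ σ τ))))) ⟩
  starts σ ++ List.map (k ℕ.+_) (skewCuts τ) ∎
  where open ≡-Reasoning

-- The empty word is excluded: its `starts` is empty.
Indecomposable : ∀ {n} → Word n → Set
Indecomposable π = starts π ≡ 0 ∷ []

skewCuts-0 : ∀ {n} (π : Word n) → ∃[ ps ] skewCuts π ≡ 0 ∷ ps
skewCuts-0 π = _ , List.filter-accept (skewCut? π) (cut-0 π)

gaps : List ℕ → List ℕ
gaps ps = zipWith ℕ._∸_ (drop 1 ps) ps

gaps-map-+ : ∀ k p ps → gaps (List.map (k ℕ.+_) (p ∷ ps)) ≡ gaps (p ∷ ps)
gaps-map-+ k p []       = refl
gaps-map-+ k p (q ∷ ps) = cong₂ _∷_ (ℕ.[m+n]∸[m+o]≡n∸o k q p) (gaps-map-+ k q ps)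

componentSizes-⊖ : ∀ {k m} (σ : Word k) (τ : Word m) → Indecomposable σ →
  componentSizes (σ ⊖ τ) ≡ k ∷ componentSizes τ
componentSizes-⊖ {k} σ τ indec with skewCuts-0 τ
... | ps , eq = begin
  gaps (skewCuts (σ ⊖ τ))
    ≡⟨ cong gaps (trans (skewCuts-⊖ σ τ) (cong₂ (λ s c → s ++ List.map (k ℕ.+_) c) indec eq)) ⟩
  k ℕ.+ 0 ∷ gaps (List.map (k ℕ.+_) (0 ∷ ps))
    ≡⟨ cong₂ _∷_ (ℕ.+-identityʳ k) (gaps-map-+ k 0 ps) ⟩
  k ∷ gaps (0 ∷ ps)
    ≡⟨ cong (λ c → k ∷ gaps c) (sym eq) ⟩
  k ∷ componentSizes τ ∎
  where open ≡-Reasoning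

length-gaps-≢1 : ∀ p q ps k → length (gaps ((p ∷ q ∷ ps) ++ k ∷ [])) ≢ 1
length-gaps-≢1 p q []       k ()
length-gaps-≢1 p q (r ∷ ps) k ()

indecomposable⇒ : ∀ {n} (π : Word n) → Indecomposable π → componentSizes π ≡ n ∷ []
indecomposable⇒ {n} π indec =
  trans (cong gaps (skewCuts-starts π)) (cong (λ s → gaps (s ++ n ∷ [])) indec)

⇒indecomposable : ∀ {n} (π : Word n) → length (componentSizes π) ≡ 1 → Indecomposable π
⇒indecomposable {zero}  π ()
⇒indecomposable {suc n} π len =
  trans 0∷ (cong (0 ∷_) (nil _ (subst (λ c → length (gaps c) ≡ 1)
    (trans (skewCuts-starts π) (cong (_++ suc n ∷ []) 0∷)) len)))
  where
  0∷ : starts π ≡ 0 ∷ filter (skewCut? π) (applyUpTo suc n)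
  0∷ = List.filter-accept (skewCut? π) (cut-0 π)
  nil : ∀ ps → length (gaps ((0 ∷ ps) ++ suc n ∷ [])) ≡ 1 → ps ≡ []
  nil []       _  = refl
  nil (p ∷ ps) eq = ⊥-elim (length-gaps-≢1 0 p ps (suc n) eq)

indecomposable-no-cut : ∀ {n} (π : Word n) → Indecomposable π →
  ∀ p → suc p ℕ.< n → ¬ SkewCut π (suc p)
indecomposable-no-cut {n} π indec p p<n cut
  with subst (suc p ∈_) indec (∈-filter⁺ (skewCut? π) (∈-upTo⁺ p<n) cut)
... | here ()
... | there ()

least : ∀ {p} {P : ℕ → Set p} → Decidable P → ∀ n → P n →
  ∃[ m ] m ℕ.≤ n × P m × (∀ i → i ℕ.< m → ¬ P i)
least {P = P} P? n pn with P? 0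
... | yes p0 = 0 , ℕ.z≤n , p0 , λ _ ()
least {P = P} P? zero pn | no ¬p0 = ⊥-elim (¬p0 pn)
least {P = P} P? (suc n) pn | no ¬p0 with least (P? ∘ suc) n pn
... | m , m≤n , pm , below = suc m , ℕ.s≤s m≤n , pm , λ where
  zero    _   → ¬p0
  (suc i) i<m → below i (ℕ.s<s⁻¹ i<m)

-- The length is packed in so that skew sums with summands of different lengths can be compared by
-- `≡` without transport.
AnyWord : Set
AnyWord = Σ[ n ∈ ℕ ] Word n

infixl 6 _⊞_
_⊞_ : AnyWord → AnyWord → AnyWord
(k , σ) ⊞ (m , τ) = k ℕ.+ m , σ ⊖ τ

-- The first component ends at the least positive cut: a cut inside σ would be an earlier cut of
-- `σ ⊖ τ`.
first-component : ∀ {n} (π : Word (suc n)) → IsPermutation π →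
  ∃[ k ] ∃[ m ] Σ[ σ ∈ Word (suc k) ] Σ[ τ ∈ Word m ]
    Indecomposable σ × (suc k , σ) ⊞ (m , τ) ≡ (suc n , π)
first-component {n} π perm with least (skewCut? π ∘ suc) n (cut-n π)
... | k , k≤n , cut , below with ℕ.m≤n⇒∃[o]m+o≡n k≤n
... | m , refl with ⊖-split {suc k} {m} π perm cut
... | σ , τ , refl = k , m , σ , τ , indec , refl
  where
  indec : starts σ ≡ 0 ∷ []
  indec = trans (List.filter-accept (skewCut? σ) (cut-0 σ))
    (cong (0 ∷_) (List.filter-none (skewCut? σ) (All.tabulate λ x∈ cut′ → absurd (∈-applyUpTo⁻ suc x∈) cut′)))
    where
    absurd : ∀ {x} → ∃[ i ] (i ℕ.< k × x ≡ suc i) → ¬ SkewCut σ x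
    absurd (i , i<k , refl) cut′ = below i i<k (cut-⊖ˡ⁻ σ τ (ℕ.s≤s (ℕ.<⇒≤ i<k)) cut′)

-- Indecomposables as one-point extensions

-- An indecomposable permutation avoiding 213 starts with its minimum, and one
-- avoiding 132 ends with its maximum; extend adds that point.
extend : Class → ∀ {n} → Word n → Word (suc n)
extend av213 τ = zero ∷ Vec.map suc τ
extend av132 {n} τ = Vec.map inject₁ τ ∷ʳ Fin.fromℕ n

lookup-∷ʳ-inject₁ : ∀ {a} {A : Set a} {n} (xs : Vec A n) x i → lookup (xs ∷ʳ x) (inject₁ i) ≡ lookup xs i
lookup-∷ʳ-inject₁ (y ∷ xs) x zero    = refl
lookup-∷ʳ-inject₁ (y ∷ xs) x (suc i) = lookup-∷ʳ-inject₁ xs x i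

lookup-∷ʳ-fromℕ : ∀ {a} {A : Set a} {n} (xs : Vec A n) x → lookup (xs ∷ʳ x) (Fin.fromℕ n) ≡ x
lookup-∷ʳ-fromℕ []       x = refl
lookup-∷ʳ-fromℕ (y ∷ xs) x = lookup-∷ʳ-fromℕ xs x

extend-embeds : ∀ κ {n} (τ : Word n) → extend κ τ Embeds τ
extend-embeds av213 τ = record
  { embed = suc ; posShift = 1 ; valShift = 1 ; embed-pos = λ _ → refl
  ; embed-val = λ i → cong toℕ (Vec.lookup-map i suc τ) }
extend-embeds av132 {n} τ = record
  { embed = inject₁ ; posShift = 0 ; valShift = 0 ; embed-pos = Fin.toℕ-inject₁
  ; embed-val = λ i → trans (cong toℕ (trans (lookup-∷ʳ-inject₁ (Vec.map inject₁ τ) _ i)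
      (Vec.lookup-map i inject₁ τ))) (Fin.toℕ-inject₁ (lookup τ i)) }

<-from-≮ : ∀ {n} {π : Word n} → IsPermutation π → ∀ {i j} → i ≢ j → ¬ (lookup π i Fin.< lookup π j) →
  lookup π j Fin.< lookup π i
<-from-≮ {π = π} perm {i} {j} i≢j i≮j =
  ℕ.≤∧≢⇒< (ℕ.≮⇒≥ i≮j) (λ eq → i≢j (sym (perm-val {π = π} perm j i eq)))

-- If the value 0 stood further right, there would be a cut just before it: an entry before it and a
-- larger entry after it would form 213 with 0 in the middle.
min-first : ∀ {n} (π : Word (suc n)) → IsPermutation π → Avoids av213 π → Indecomposable π →
  lookup π zero ≡ zero
min-first {n} π perm av indec with perm-surjective {π = π} perm zero
... | zero  , eq = eq
... | suc p , eq = ⊥-elim (indecomposable-no-cut π indec (toℕ p) (ℕ.s≤s (Fin.toℕ<n p)) cut)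
  where
  above : ∀ i → toℕ i ℕ.< suc (toℕ p) → lookup π (suc p) Fin.< lookup π i
  above i i<p = <-from-≮ {π = π} perm (λ { refl → ℕ.<-irrefl refl i<p })
    λ lt → ℕ.n≮0 (subst (λ v → lookup π i Fin.< v) eq lt)
  cut : SkewCut π (suc (toℕ p))
  cut i j i<p p≤j with ℕ.m≤n⇒m<n∨m≡n p≤j
  ... | inj₂ p≡j rewrite sym (Fin.toℕ-injective {i = suc p} {j = j} p≡j) = above i i<p
  ... | inj₁ p<j = <-from-≮ {π = π} perm (λ { refl → ℕ.<-asym i<p p<j })
    λ lt → av i (suc p) j i<p p<j (above i i<p , lt)

-- If the maximum stood further left, there would be a cut just after it: an entry before it and a
-- larger entry after it would form 132 with the maximum in the middle.
max-last : ∀ {n} (π : Word (suc n)) → IsPermutation π → Avoids av132 π → Indecomposable π →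
  lookup π (Fin.fromℕ n) ≡ Fin.fromℕ n
max-last {n} π perm av indec with perm-surjective {π = π} perm (Fin.fromℕ n)
... | q , eq with view q
... | ‵fromℕ = eq
... | ‵inject₁ p = ⊥-elim (indecomposable-no-cut π indec (toℕ q) (ℕ.s≤s q<n) cut)
  where
  q<n : toℕ q ℕ.< n
  q<n = subst (ℕ._< n) (sym (Fin.toℕ-inject₁ p)) (Fin.toℕ<n p)
  below : ∀ j → q ≢ j → lookup π j Fin.< lookup π q
  below j q≢j = ℕ.≤∧≢⇒<
    (subst (λ v → val π j ℕ.≤ toℕ v) (sym eq) (Fin.≤fromℕ (lookup π j)))
    λ same → q≢j (sym (perm-val {π = π} perm j q same))
  cut : SkewCut π (suc (toℕ q))
  cut i j i≤q q<j with ℕ.m≤n⇒m<n∨m≡n (ℕ.s≤s⁻¹ i≤q)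
  ... | inj₂ i≡q rewrite Fin.toℕ-injective {i = i} {j = q} i≡q =
    below j λ { refl → ℕ.<-irrefl refl q<j }
  ... | inj₁ i<q = <-from-≮ {π = π} perm (λ { refl → ℕ.<-asym i<q q<j })
    λ lt → av i q j i<q q<j (lt , below j λ { refl → ℕ.<-irrefl refl q<j })

indecomposable-extend : ∀ κ {n} (π : Word (suc n)) → IsPermutation π → Avoids κ π →
  Indecomposable π → ∃[ τ ] extend κ τ ≡ π
indecomposable-extend av213 {n} π perm av indec = τ , lookup-ext same
  where
  first : lookup π zero ≡ zero
  first = min-first π perm av indec
  0≢ : ∀ i → zero ≢ lookup π (suc i)
  0≢ i eq with () ← perm zero (suc i) (trans first eq)
  τ : Word n
  τ = tabulate λ i → Fin.punchOut (0≢ i)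
  same : ∀ i → lookup (extend av213 τ) i ≡ lookup π i
  same zero    = sym first
  same (suc i) = trans (Vec.lookup-map i suc τ) (trans (cong suc (Vec.lookup∘tabulate _ i))
    (Fin.punchIn-punchOut (0≢ i)))
indecomposable-extend av132 {n} π perm av indec = τ , val-ext same
  where
  last : lookup π (Fin.fromℕ n) ≡ Fin.fromℕ n
  last = max-last π perm av indec
  n≢ : ∀ i → n ≢ val π (inject₁ i)
  n≢ i eq = Fin.fromℕ≢inject₁ (perm-val {π = π} perm (Fin.fromℕ n) (inject₁ i)
    (trans (cong toℕ last) (trans (Fin.toℕ-fromℕ n) eq)))
  τ : Word n
  τ = tabulate λ i → Fin.lower₁ (lookup π (inject₁ i)) (n≢ i)
  same : ∀ i → val (extend av132 τ) i ≡ val π i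
  same i with view i
  ... | ‵fromℕ     = cong toℕ (trans (lookup-∷ʳ-fromℕ (Vec.map inject₁ τ) _) (sym last))
  ... | ‵inject₁ j = trans (embed-val (extend-embeds av132 τ) j)
    (trans (cong toℕ (Vec.lookup∘tabulate _ j)) (Fin.toℕ-lower₁ _ (n≢ j)))

-- Placements

-- An injection given as a relation, which may carry side conditions and needs no explicit inverse.
-- The partner of the head is removed from ys; the other partners survive because a y belongs to at
-- most one x.
matching : ∀ {a b r} {A : Set a} {B : Set b} (R : A → B → Set r) →
  (∀ {x x′ y} → R x y → R x′ y → x ≡ x′) →
  ∀ {xs} ys → Unique xs → (∀ {x} → x ∈ xs → ∃[ y ] y ∈ ys × R x y) →
  ∃[ zs ] ∃[ ws ] Pointwise R xs zs × ys ↭ zs ++ ws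
matching R inj {[]}     ys uniq partner = [] , ys , [] , ↭-refl
matching R inj {x ∷ xs} ys (x∉ ∷ uniq) partner with partner (here refl)
... | y , y∈ , rxy with ∈-∃++ y∈
... | as , bs , refl with matching R inj {xs} (as ++ bs) uniq partner′
  where
  partner′ : ∀ {x′} → x′ ∈ xs → ∃[ y′ ] y′ ∈ as ++ bs × R x′ y′
  partner′ x′∈ with partner (there x′∈)
  ... | y′ , y′∈ , rx′y′ with ∈-++⁻ as y′∈
  ...   | inj₁ l           = y′ , ∈-++⁺ˡ l , rx′y′
  ...   | inj₂ (there r)   = y′ , ∈-++⁺ʳ as r , rx′y′
  -- A partner shared with x would identify x′ with x, which occurs only once in the list.
  ...   | inj₂ (here refl) = ⊥-elim (All.lookup x∉ x′∈ (inj rxy rx′y′))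
... | zs , ws , rs , perm = y ∷ zs , ws , rxy ∷ rs , ↭-trans (shift y as bs) (↭-prep y perm)

length-matching : ∀ {a b r} {A : Set a} {B : Set b} (R : A → B → Set r) →
  (∀ {x x′ y} → R x y → R x′ y → x ≡ x′) →
  ∀ {xs} ys → Unique xs → (∀ {x} → x ∈ xs → ∃[ y ] y ∈ ys × R x y) →
  length xs ℕ.≤ length ys
length-matching R inj {xs} ys uniq partner with matching R inj ys uniq partner
... | zs , ws , rs , perm = begin
  length xs               ≡⟨ Pointwise.Pointwise-length rs ⟩
  length zs               ≤⟨ ℕ.m≤m+n (length zs) (length ws) ⟩
  length zs ℕ.+ length ws ≡⟨ sym (List.length-++ zs) ⟩
  length (zs ++ ws)       ≡⟨ sym (↭-length perm) ⟩
  length ys               ∎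
  where open ℕ.≤-Reasoning

∈-allVecs : ∀ k m (v : Vec (Fin k) m) → v ∈ allVecs k m
∈-allVecs k zero    []      = here refl
∈-allVecs k (suc m) (x ∷ v) = ∈-cartesianProductWith⁺ _∷_ (∈-allFin x) (∈-allVecs k m v)

allVecs-unique : ∀ k m → Unique (allVecs k m)
allVecs-unique k zero    = All.[] ∷ []
allVecs-unique k (suc m) =
  Unique.cartesianProductWith⁺ _∷_ (λ { refl → refl , refl }) (Unique.allFin⁺ k) (allVecs-unique k m)

length-cartesianProductWith : ∀ {a b c} {A : Set a} {B : Set b} {C : Set c} (f : A → B → C) xs ys →
  length (List.cartesianProductWith f xs ys) ≡ length xs ℕ.* length ys
length-cartesianProductWith f []       ys = refl
length-cartesianProductWith f (x ∷ xs) ys = trans (List.length-++ (List.map (f x) ys))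
  (cong₂ ℕ._+_ (List.length-map (f x) ys) (length-cartesianProductWith f xs ys))

length-allVecs : ∀ k m → length (allVecs k m) ≡ k ℕ.^ m
length-allVecs k zero    = refl
length-allVecs k (suc m) = trans (length-cartesianProductWith _∷_ (List.allFin k) (allVecs k m))
  (cong₂ ℕ._*_ (List.length-tabulate {n = k} id) (length-allVecs k m))

scanl-+ : ∀ a b w → scanl ℕ._+_ (a ℕ.+ b) w ≡ List.map (a ℕ.+_) (scanl ℕ._+_ b w)
scanl-+ a b []      = refl
scanl-+ a b (k ∷ w) = cong (a ℕ.+ b ∷_)
  (trans (cong (λ s → scanl ℕ._+_ s w) (ℕ.+-assoc a b k)) (scanl-+ a (b ℕ.+ k) w))

gates-∷ : ∀ k w → gates (k ∷ w) ≡ 0 ∷ List.map (k ℕ.+_) (gates w)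
gates-∷ k w = cong (0 ∷_) (trans (cong (λ s → scanl ℕ._+_ s w) (sym (ℕ.+-identityʳ k))) (scanl-+ k 0 w))

0∈gates : ∀ w → 0 ∈ gates w
0∈gates []      = here refl
0∈gates (k ∷ w) = here refl

+∈gates : ∀ k w {t} → t ∈ gates w → k ℕ.+ t ∈ gates (k ∷ w)
+∈gates k w {t} t∈ = subst (k ℕ.+ t ∈_) (sym (gates-∷ k w)) (there (∈-map⁺ (k ℕ.+_) t∈))

-- The order embedding that stretches each component of w to the size of the
-- corresponding component of w′.
stretch : List ℕ → List ℕ → ℕ → ℕ
stretch (k ∷ w) (k′ ∷ w′) t with t ℕ.<? k
... | yes _ = t
... | no  _ = k′ ℕ.+ stretch w w′ (t ℕ.∸ k)
stretch _ _ t = t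

stretch-< : ∀ {w w′} → Pointwise ℕ._≤_ w w′ → ∀ {s t} → s ℕ.< t → stretch w w′ s ℕ.< stretch w w′ t
stretch-< []                                       s<t = s<t
stretch-< {k ∷ w} {k′ ∷ w′} (k≤k′ ∷ w≤w′) {s} {t} s<t with s ℕ.<? k | t ℕ.<? k
... | yes _   | yes _   = s<t
... | yes s<k | no  _   = ℕ.<-≤-trans s<k (ℕ.≤-trans k≤k′ (ℕ.m≤m+n k′ _))
... | no  s≮k | yes t<k = ⊥-elim (s≮k (ℕ.<-trans s<t t<k))
... | no  s≮k | no  _   = ℕ.+-monoʳ-< k′ (stretch-< w≤w′ (ℕ.∸-monoˡ-< s<t (ℕ.≮⇒≥ s≮k)))

stretch-≤ : ∀ {w w′} → Pointwise ℕ._≤_ w w′ → ∀ {s t} → s ℕ.≤ t → stretch w w′ s ℕ.≤ stretch w w′ t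
stretch-≤ w≤w′ s≤t with ℕ.m≤n⇒m<n∨m≡n s≤t
... | inj₁ s<t  = ℕ.<⇒≤ (stretch-< w≤w′ s<t)
... | inj₂ refl = ℕ.≤-refl

stretch-injective : ∀ {w w′} → Pointwise ℕ._≤_ w w′ → ∀ s t → stretch w w′ s ≡ stretch w w′ t → s ≡ t
stretch-injective w≤w′ s t eq with ℕ.<-cmp s t
... | tri< s<t _ _ = ⊥-elim (ℕ.<-irrefl eq (stretch-< w≤w′ s<t))
... | tri≈ _ s≡t _ = s≡t
... | tri> _ _ t<s = ⊥-elim (ℕ.<-irrefl (sym eq) (stretch-< w≤w′ t<s))

stretch-bound : ∀ {w w′} → Pointwise ℕ._≤_ w w′ → ∀ {t} → t ℕ.≤ sum w →
  stretch w w′ t ℕ.≤ sum w′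
stretch-bound []                                   t≤ = t≤
stretch-bound {k ∷ w} {k′ ∷ w′} (k≤k′ ∷ w≤w′) {t} t≤ with t ℕ.<? k
... | yes t<k = ℕ.≤-trans (ℕ.<⇒≤ t<k) (ℕ.≤-trans k≤k′ (ℕ.m≤m+n k′ _))
... | no  _   = ℕ.+-monoʳ-≤ k′ (stretch-bound w≤w′ (ℕ.m≤n+o⇒m∸n≤o t k t≤))

stretch-gates : ∀ {w w′} → Pointwise ℕ._≤_ w w′ → ∀ {t} → t ∈ gates w → stretch w w′ t ∈ gates w′
stretch-gates []                                  t∈ = t∈
stretch-gates {k ∷ w} {k′ ∷ w′} (k≤k′ ∷ w≤w′) {t} t∈
  with t ℕ.<? k | subst (t ∈_) (gates-∷ k w) t∈
... | yes _   | here refl = 0∈gates (k′ ∷ w′)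
... | no  _   | here refl = +∈gates k′ w′ (stretch-gates w≤w′ (subst (_∈ gates w) (sym (ℕ.0∸n≡0 k)) (0∈gates w)))
... | yes t<k | there t∈′ with u , _ , refl ← ∈-map⁻ (k ℕ.+_) t∈′ = ⊥-elim (ℕ.m+n≮m k u t<k)
... | no  _   | there t∈′ with u , u∈ , refl ← ∈-map⁻ (k ℕ.+_) t∈′ =
  +∈gates k′ w′ (stretch-gates w≤w′ (subst (_∈ gates w) (sym (ℕ.m+n∸m≡n k u)) u∈))

-- `IsAdmissiblePlacement` with the cell replaced by a list of sizes. For a known axis the two
-- unfold to the same type, so `N≡count` only has to rewrite the size of the cell.
Admissible : Axis → (D : DominoCell) → List ℕ → ∀ {n} → Vec (Fin (suc n)) (size D) → Set
Admissible a D w f =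
  (∀ i j → coordinate a D i Fin.≤ coordinate a D j → lookup f i Fin.≤ lookup f j) ×
  (∀ i → ¬ Leaf D i → toℕ (lookup f i) ∈ gates w)

admissible? : ∀ a D w {n} → Decidable (Admissible a D w {n})
admissible? a D w f =
  (Fin.all? λ i → Fin.all? λ j →
    (coordinate a D i Fin.≤? coordinate a D j) →-dec (lookup f i Fin.≤? lookup f j))
  ×-dec
  (Fin.all? λ i → ¬? (leaf? D i) →-dec _∈?_ ℕ._≟_ (toℕ (lookup f i)) (gates w))

placements : ∀ a D w n → List (Vec (Fin (suc n)) (size D))
placements a D w n = filter (admissible? a D w) (allVecs (suc n) (size D))

alongAxis : Axis → List ℕ → List ℕ
alongAxis position w = w
alongAxis value    w = reverse w

-- N(C; D) as a function of the component sizes of C alone.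
count : Axis → DominoCell → List ℕ → ℕ
count a D w = length (placements a D (alongAxis a w) (sum w))

N≡count : ∀ a {n} (C : Word n) D → sum (componentSizes C) ≡ n → N a C D ≡ count a D (componentSizes C)
N≡count position C D eq = cong (λ n → length (placements position D (componentSizes C) n)) (sym eq)
N≡count value    C D eq = cong (λ n → length (placements value D (reverse (componentSizes C)) n)) (sym eq)

placements-mono : ∀ a D {w w′} → Pointwise ℕ._≤_ w w′ →
  length (placements a D w (sum w)) ℕ.≤ length (placements a D w′ (sum w′))
placements-mono a D {w} {w′} w≤w′ = length-matching R (λ {f} {f′} {g} → inj f f′ g) (placements a D w′ (sum w′))
  (Unique.filter⁺ (admissible? a D w) (allVecs-unique _ (size D)))
  λ {f} f∈ → let g = λ i → Fin.fromℕ< (image< f i) in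
    tabulate g ,
    ∈-filter⁺ (admissible? a D w′) (∈-allVecs _ _ (tabulate g))
      (transport f (tabulate g) (image f) (proj₂ (∈-filter⁻ (admissible? a D w) {xs = allVecs _ _} f∈))) ,
    image f
  where
  φ = stretch w w′
  R : Vec (Fin (suc (sum w))) (size D) → Vec (Fin (suc (sum w′))) (size D) → Set
  R f g = ∀ i → toℕ (lookup g i) ≡ φ (toℕ (lookup f i))
  inj : ∀ f f′ g → R f g → R f′ g → f ≡ f′
  inj f f′ g r r′ = lookup-ext λ i → Fin.toℕ-injective
    (stretch-injective w≤w′ _ _ (trans (sym (r i)) (r′ i)))
  image< : ∀ (f : Vec (Fin (suc (sum w))) (size D)) i → φ (toℕ (lookup f i)) ℕ.< suc (sum w′)
  image< f i = ℕ.s≤s (stretch-bound w≤w′ (Fin.toℕ≤pred[n] (lookup f i)))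
  image : ∀ f → R f (tabulate (λ i → Fin.fromℕ< (image< f i)))
  image f i = trans (cong toℕ (Vec.lookup∘tabulate _ i)) (Fin.toℕ-fromℕ< (image< f i))
  transport : ∀ f g → R f g → Admissible a D w f → Admissible a D w′ g
  transport f g r (mono , gated) =
    (λ i j i≤j → subst₂ ℕ._≤_ (sym (r i)) (sym (r j)) (stretch-≤ w≤w′ (mono i j i≤j))) ,
    (λ i ¬leaf → subst (_∈ gates w′) (sym (r i)) (stretch-gates w≤w′ (gated i ¬leaf)))

sum-reverse : ∀ w → sum (reverse w) ≡ sum w
sum-reverse w = sum-↭ (↭-reverse w)

-- Reversal preserves the componentwise order, so the counts along both axes increase in the same
-- vector w. This common direction is what makes their correlation nonnegative.
count-mono : ∀ a D {w w′} → Pointwise ℕ._≤_ w w′ → count a D w ℕ.≤ count a D w′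
count-mono position D w≤w′ = placements-mono position D w≤w′
count-mono value D {w} {w′} w≤w′ = subst₂ ℕ._≤_
  (cong (λ n → length (placements value D (reverse w) n)) (sum-reverse w))
  (cong (λ n → length (placements value D (reverse w′) n)) (sum-reverse w′))
  (placements-mono value D (Pointwise.reverse⁺ w≤w′))

-- A crude bound by the number of all maps; being polynomial in n, it suffices for convergence.
N-bound : ∀ a {n} (C : Word n) D → N a C D ℕ.≤ suc n ℕ.^ size D
N-bound a {n} C D = subst (N a C D ℕ.≤_) (length-allVecs (suc n) (size D))
  (List.length-filter (isAdmissiblePlacement? a C D) (allVecs (suc n) (size D)))

-- Harris' inequality

-- Proves an inequality by naming its slack d, which leaves an identity for the ring solver.
≤-by-gap : ∀ {p q} d → 0ℚ ≤ d → q ≡ p + d → p ≤ q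
≤-by-gap {p} {q} d 0≤d eq = subst₂ _≤_ (ℚ.+-identityʳ p) (sym eq) (ℚ.+-monoʳ-≤ p 0≤d)

gap : ∀ {p q} → p ≤ q → 0ℚ ≤ q - p
gap {p} {q} p≤q = subst (_≤ q - p) (ℚ.+-inverseʳ p) (ℚ.+-monoˡ-≤ (- p) p≤q)

*-monoʳ-nonNeg : ∀ {p q} r → 0ℚ ≤ r → p ≤ q → r * p ≤ r * q
*-monoʳ-nonNeg r 0≤r = ℚ.*-monoˡ-≤-nonNeg r {{nonNegative 0≤r}}

*-monoˡ-nonNeg : ∀ {p q} r → 0ℚ ≤ r → p ≤ q → p * r ≤ q * r
*-monoˡ-nonNeg r 0≤r = ℚ.*-monoʳ-≤-nonNeg r {{nonNegative 0≤r}}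

0≤* : ∀ {p q} → 0ℚ ≤ p → 0ℚ ≤ q → 0ℚ ≤ p * q
0≤* {p} {q} 0≤p 0≤q = subst (_≤ p * q) (ℚ.*-zeroʳ p) (*-monoʳ-nonNeg p 0≤p 0≤q)

0≤+ : ∀ {p q} → 0ℚ ≤ p → 0ℚ ≤ q → 0ℚ ≤ p + q
0≤+ {p} {q} 0≤p 0≤q = subst (_≤ p + q) (ℚ.+-identityˡ 0ℚ) (ℚ.+-mono-≤ 0≤p 0≤q)

0≤1 : 0ℚ ≤ 1ℚ
0≤1 = ℚ.<⇒≤ (ℚ.positive⁻¹ 1ℚ)

pow : ℚ → ℕ → ℚ
pow x zero    = 1ℚ
pow x (suc n) = x * pow x n

pow-nonNeg : ∀ {x} → 0ℚ ≤ x → ∀ n → 0ℚ ≤ pow x n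
pow-nonNeg 0≤x zero    = 0≤1
pow-nonNeg 0≤x (suc n) = 0≤* 0≤x (pow-nonNeg 0≤x n)

pow-pos : ∀ {x} → 0ℚ < x → ∀ n → 0ℚ < pow x n
pow-pos         0<x zero    = ℚ.positive⁻¹ 1ℚ
pow-pos {x} 0<x (suc n) = *-pos x (pow x n) 0<x (pow-pos 0<x n)

pow-mono : ∀ {x y} → 0ℚ ≤ x → x ≤ y → ∀ n → pow x n ≤ pow y n
pow-mono         0≤x x≤y zero    = ℚ.≤-refl
pow-mono {x} {y} 0≤x x≤y (suc n) = *-mono-≤-nonNeg x y (pow x n) (pow y n) 0≤x
  (pow-nonNeg (ℚ.≤-trans 0≤x x≤y) n) x≤y (pow-mono 0≤x x≤y n)

pow-≤1 : ∀ {x} → 0ℚ ≤ x → x ≤ 1ℚ → ∀ n → pow x n ≤ 1ℚ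
pow-≤1         0≤x x≤1 zero    = ℚ.≤-refl
pow-≤1 {x} 0≤x x≤1 (suc n) = *-mono-≤-nonNeg x 1ℚ (pow x n) 1ℚ 0≤x 0≤1 x≤1 (pow-≤1 0≤x x≤1 n)

pow-+ : ∀ x m n → pow x (m ℕ.+ n) ≡ pow x m * pow x n
pow-+ x zero    n = sym (ℚ.*-identityˡ (pow x n))
pow-+ x (suc m) n = trans (cong (x *_) (pow-+ x m n)) (sym (ℚ.*-assoc x (pow x m) (pow x n)))

pow-* : ∀ x y n → pow (x * y) n ≡ pow x n * pow y n
pow-* x y zero    = refl
pow-* x y (suc n) = trans (cong (x * y *_) (pow-* x y n)) (interchange x y (pow x n) (pow y n))
  where
  interchange : ∀ a b c d → a * b * (c * d) ≡ a * c * (b * d)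
  interchange = solve-∀ ring

∑ : ∀ {a} {A : Set a} → List A → (A → ℚ) → ℚ
∑ []       f = 0ℚ
∑ (x ∷ xs) f = f x + ∑ xs f

module _ {a} {A : Set a} where

  ∑-mono : ∀ {f g : A → ℚ} xs → (∀ {x} → x ∈ xs → f x ≤ g x) → ∑ xs f ≤ ∑ xs g
  ∑-mono []       f≤g = ℚ.≤-refl
  ∑-mono (x ∷ xs) f≤g = ℚ.+-mono-≤ (f≤g (here refl)) (∑-mono xs (f≤g ∘ there))

  ∑-cong : ∀ {f g : A → ℚ} xs → (∀ {x} → x ∈ xs → f x ≡ g x) → ∑ xs f ≡ ∑ xs g
  ∑-cong []       f≡g = refl
  ∑-cong (x ∷ xs) f≡g = cong₂ _+_ (f≡g (here refl)) (∑-cong xs (f≡g ∘ there))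

  ∑-nonNeg : ∀ {f : A → ℚ} xs → (∀ x → 0ℚ ≤ f x) → 0ℚ ≤ ∑ xs f
  ∑-nonNeg []       0≤f = ℚ.≤-refl
  ∑-nonNeg (x ∷ xs) 0≤f = 0≤+ (0≤f x) (∑-nonNeg xs 0≤f)

  ∑-*ˡ : ∀ r (f : A → ℚ) xs → ∑ xs (λ x → r * f x) ≡ r * ∑ xs f
  ∑-*ˡ r f []       = sym (ℚ.*-zeroʳ r)
  ∑-*ˡ r f (x ∷ xs) = trans (cong (r * f x +_) (∑-*ˡ r f xs)) (sym (ℚ.*-distribˡ-+ r (f x) (∑ xs f)))

  ∑-*ʳ : ∀ r (f : A → ℚ) xs → ∑ xs (λ x → f x * r) ≡ ∑ xs f * r
  ∑-*ʳ r f []       = sym (ℚ.*-zeroˡ r)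
  ∑-*ʳ r f (x ∷ xs) = trans (cong (f x * r +_) (∑-*ʳ r f xs)) (sym (ℚ.*-distribʳ-+ r (f x) (∑ xs f)))

  ∑-++ : ∀ (f : A → ℚ) xs ys → ∑ (xs ++ ys) f ≡ ∑ xs f + ∑ ys f
  ∑-++ f []       ys = sym (ℚ.+-identityˡ (∑ ys f))
  ∑-++ f (x ∷ xs) ys = trans (cong (f x +_) (∑-++ f xs ys)) (sym (ℚ.+-assoc (f x) (∑ xs f) (∑ ys f)))

  ∑-↭ : ∀ (f : A → ℚ) {xs ys} → xs ↭ ys → ∑ xs f ≡ ∑ ys f
  ∑-↭ f Perm.refl          = refl
  ∑-↭ f (Perm.prep x p)    = cong (f x +_) (∑-↭ f p)
  ∑-↭ f (Perm.swap {xs} {ys} x y p) = trans (cong (λ s → f x + (f y + s)) (∑-↭ f p)) (swap+ (f x) (f y) (∑ ys f))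
    where
    swap+ : ∀ a b c → a + (b + c) ≡ b + (a + c)
    swap+ = solve-∀ ring
  ∑-↭ f (Perm.trans p q)   = trans (∑-↭ f p) (∑-↭ f q)

∑-map : ∀ {a b} {A : Set a} {B : Set b} (h : A → B) (f : B → ℚ) xs →
  ∑ (List.map h xs) f ≡ ∑ xs (f ∘ h)
∑-map h f []       = refl
∑-map h f (x ∷ xs) = cong (f (h x) +_) (∑-map h f xs)

∑-cartesianProduct : ∀ {a b} {A : Set a} {B : Set b} (f : A × B → ℚ) xs ys →
  ∑ (cartesianProduct xs ys) f ≡ ∑ xs (λ x → ∑ ys (λ y → f (x , y)))
∑-cartesianProduct f []       ys = refl
∑-cartesianProduct f (x ∷ xs) ys = trans (∑-++ f (List.map (x ,_) ys) _)
  (cong₂ _+_ (∑-map (x ,_) f ys) (∑-cartesianProduct f xs ys))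

-- The comparisons of generating functions below rest on this: the entries of ys left unmatched
-- contribute nonnegative terms.
∑-matching : ∀ {a b r} {A : Set a} {B : Set b} (R : A → B → Set r) →
  (∀ {x x′ y} → R x y → R x′ y → x ≡ x′) →
  ∀ {xs} ys (f : A → ℚ) (g : B → ℚ) → Unique xs → (∀ {x} → x ∈ xs → ∃[ y ] y ∈ ys × R x y) →
  (∀ {x y} → R x y → f x ≤ g y) → (∀ y → 0ℚ ≤ g y) → ∑ xs f ≤ ∑ ys g
∑-matching R inj {xs} ys f g uniq partner f≤g 0≤g with matching R inj ys uniq partner
... | zs , ws , rs , perm = begin
  ∑ xs f            ≤⟨ matched rs ⟩
  ∑ zs g            ≡⟨ sym (ℚ.+-identityʳ (∑ zs g)) ⟩
  ∑ zs g + 0ℚ       ≤⟨ ℚ.+-monoʳ-≤ (∑ zs g) (∑-nonNeg ws 0≤g) ⟩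
  ∑ zs g + ∑ ws g   ≡⟨ sym (∑-++ g zs ws) ⟩
  ∑ (zs ++ ws) g    ≡⟨ sym (∑-↭ g perm) ⟩
  ∑ ys g            ∎
  where
  open ℚ.≤-Reasoning
  matched : ∀ {xs zs} → Pointwise R xs zs → ∑ xs f ≤ ∑ zs g
  matched []       = ℚ.≤-refl
  matched (r ∷ rs) = ℚ.+-mono-≤ (f≤g r) (matched rs)

module _ {a} {A : Set a} (w f g : A → ℚ) where

  private
    W F G FG : List A → ℚ
    W  xs = ∑ xs w
    F  xs = ∑ xs (λ x → w x * f x)
    G  xs = ∑ xs (λ x → w x * g x)
    FG xs = ∑ xs (λ x → w x * (f x * g x))

  ∑-spread : ∀ p q xs → ∑ xs (λ x → w x * ((p - f x) * (q - g x))) ≡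
    p * q * W xs - p * G xs - q * F xs + FG xs
  ∑-spread p q []       = base p q
    where
    base : ∀ p q → 0ℚ ≡ p * q * 0ℚ - p * 0ℚ - q * 0ℚ + 0ℚ
    base = solve-∀ ring
  ∑-spread p q (x ∷ xs) = trans (cong (w x * ((p - f x) * (q - g x)) +_) (∑-spread p q xs))
    (step p q (w x) (f x) (g x) (W xs) (F xs) (G xs) (FG xs))
    where
    step : ∀ p q w f g W F G FG →
      w * ((p - f) * (q - g)) + (p * q * W - p * G - q * F + FG) ≡
      p * q * (w + W) - p * (w * g + G) - q * (w * f + F) + (w * (f * g) + FG)
    step = solve-∀ ring

  -- W FG - F G is the sum of w x w y (f x - f y) (g x - g y) over pairs of entries. Prefixing x
  -- adds the pairs that contain x, and `∑-spread` evaluates their sum.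
  chebyshev : (∀ x → 0ℚ ≤ w x) → (∀ x y → 0ℚ ≤ (f x - f y) * (g x - g y)) →
    ∀ xs → F xs * G xs ≤ W xs * FG xs
  chebyshev 0≤w co []       = ℚ.≤-refl
  chebyshev 0≤w co (x ∷ xs) = ≤-by-gap
    ((W xs * FG xs - F xs * G xs) + w x * (f x * g x * W xs - f x * G xs - g x * F xs + FG xs))
    (0≤+ (gap (chebyshev 0≤w co xs)) (0≤* (0≤w x)
      (subst (0ℚ ≤_) (∑-spread (f x) (g x) xs) (∑-nonNeg xs λ y → 0≤* (0≤w y) (co x y)))))
    (step (w x) (f x) (g x) (W xs) (F xs) (G xs) (FG xs))
    where
    step : ∀ w f g W F G FG → (w + W) * (w * (f * g) + FG) ≡
      (w * f + F) * (w * g + G) + ((W * FG - F * G) + w * (f * g * W - f * G - g * F + FG))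
    step = solve-∀ ring

co-monotone : ∀ {f g : ℕ → ℚ} → (∀ {m n} → m ℕ.≤ n → f m ≤ f n) → (∀ {m n} → m ℕ.≤ n → g m ≤ g n) →
  ∀ m n → 0ℚ ≤ (f m - f n) * (g m - g n)
co-monotone {f} {g} mono-f mono-g m n with ℕ.≤-total n m
... | inj₁ n≤m = 0≤* (gap (mono-f n≤m)) (gap (mono-g n≤m))
... | inj₂ m≤n = subst (0ℚ ≤_) (flip (f m) (f n) (g m) (g n)) (0≤* (gap (mono-f m≤n)) (gap (mono-g m≤n)))
  where
  flip : ∀ a b c d → (b - a) * (d - c) ≡ (a - b) * (c - d)
  flip = solve-∀ ring

Increasing : (List ℕ → ℚ) → Set
Increasing F = ∀ {w w′} → Pointwise ℕ._≤_ w w′ → F w ≤ F w′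

increasing-∷ : ∀ {F} → Increasing F → ∀ k → Increasing (λ w → F (k ∷ w))
increasing-∷ mono k w≤w′ = mono (ℕ.≤-refl ∷ w≤w′)

-- c independent components drawn from X, each weighted by x ^ size.
box : List AnyWord → ℚ → ℕ → (List ℕ → ℚ) → ℚ
box X x zero    F = F []
box X x (suc c) F = ∑ X (λ σ → pow x (proj₁ σ) * box X x c (λ w → F (proj₁ σ ∷ w)))

weight : List AnyWord → ℚ → ℚ
weight X x = ∑ X (λ σ → pow x (proj₁ σ))

module _ (X : List AnyWord) {x : ℚ} (0≤x : 0ℚ ≤ x) where

  box-mono : ∀ c {F G} → (∀ w → F w ≤ G w) → box X x c F ≤ box X x c G
  box-mono zero    F≤G = F≤G []
  box-mono (suc c) F≤G = ∑-mono X λ {σ} _ →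
    *-monoʳ-nonNeg _ (pow-nonNeg 0≤x (proj₁ σ)) (box-mono c λ w → F≤G (proj₁ σ ∷ w))

  box-nonNeg : ∀ c {F} → (∀ w → 0ℚ ≤ F w) → 0ℚ ≤ box X x c F
  box-nonNeg zero    0≤F = 0≤F []
  box-nonNeg (suc c) 0≤F = ∑-nonNeg X λ σ →
    0≤* (pow-nonNeg 0≤x (proj₁ σ)) (box-nonNeg c λ w → 0≤F (proj₁ σ ∷ w))

  weight-nonNeg : 0ℚ ≤ weight X x
  weight-nonNeg = ∑-nonNeg X λ σ → pow-nonNeg 0≤x (proj₁ σ)

  box-1 : ∀ c → box X x c (λ _ → 1ℚ) ≡ pow (weight X x) c
  box-1 zero    = refl
  box-1 (suc c) = trans (∑-*ʳ (box X x c (λ _ → 1ℚ)) (λ σ → pow x (proj₁ σ)) X)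
    (cong (weight X x *_) (box-1 c))

  -- By Chebyshev's sum inequality in each coordinate in turn.
  harris : ∀ c {F G} → Increasing F → Increasing G →
    box X x c F * box X x c G ≤ pow (weight X x) c * box X x c (λ w → F w * G w)
  harris zero    {F} {G} mono-F mono-G = ℚ.≤-reflexive (sym (ℚ.*-identityˡ (F [] * G [])))
  harris (suc c) {F} {G} mono-F mono-G = begin
    ∑ X (λ σ → u σ * f (proj₁ σ)) * ∑ X (λ σ → u σ * g (proj₁ σ))
      ≤⟨ chebyshev u (f ∘ proj₁) (g ∘ proj₁) (λ σ → pow-nonNeg 0≤x (proj₁ σ))
           (λ σ τ → co-monotone {f} {g} f-mono g-mono (proj₁ σ) (proj₁ τ)) X ⟩
    weight X x * ∑ X (λ σ → u σ * (f (proj₁ σ) * g (proj₁ σ)))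
      ≤⟨ *-monoʳ-nonNeg (weight X x) weight-nonNeg (∑-mono X λ {σ} _ →
           *-monoʳ-nonNeg (u σ) (pow-nonNeg 0≤x (proj₁ σ))
             (harris c (increasing-∷ mono-F (proj₁ σ)) (increasing-∷ mono-G (proj₁ σ)))) ⟩
    weight X x * ∑ X (λ σ → u σ * (Wᶜ * fg (proj₁ σ)))
      ≡⟨ cong (weight X x *_) (trans (∑-cong X λ {σ} _ → pull (u σ) Wᶜ (fg (proj₁ σ)))
           (∑-*ˡ Wᶜ _ X)) ⟩
    weight X x * (Wᶜ * ∑ X (λ σ → u σ * fg (proj₁ σ)))
      ≡⟨ sym (ℚ.*-assoc (weight X x) Wᶜ _) ⟩
    weight X x * Wᶜ * ∑ X (λ σ → u σ * fg (proj₁ σ)) ∎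
    where
    open ℚ.≤-Reasoning
    Wᶜ = pow (weight X x) c
    u : AnyWord → ℚ
    u σ = pow x (proj₁ σ)
    f g fg : ℕ → ℚ
    f k = box X x c (λ w → F (k ∷ w))
    g k = box X x c (λ w → G (k ∷ w))
    fg k = box X x c (λ w → F (k ∷ w) * G (k ∷ w))
    f-mono : ∀ {m n} → m ℕ.≤ n → f m ≤ f n
    f-mono m≤n = box-mono c λ w → mono-F (m≤n ∷ Pointwise.refl ℕ.≤-refl)
    g-mono : ∀ {m n} → m ℕ.≤ n → g m ≤ g n
    g-mono m≤n = box-mono c λ w → mono-G (m≤n ∷ Pointwise.refl ℕ.≤-refl)
    pull : ∀ a b c → a * (b * c) ≡ b * (a * c)
    pull = solve-∀ ring

-- Generating functions of cells

module _ {p} {P : AnyWord → Set p} (P? : Decidable P) where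

  wordsOf : ∀ n → List (Word n)
  wordsOf n = filter (λ π → P? (n , π)) (allVecs n n)

  wordsBelow : ℕ → List AnyWord
  wordsBelow zero    = []
  wordsBelow (suc L) = wordsBelow L ++ List.map (L ,_) (wordsOf L)

  ∈-wordsBelow⁺ : ∀ L {w} → proj₁ w ℕ.< L → P w → w ∈ wordsBelow L
  ∈-wordsBelow⁺ (suc L) {n , π} n<L pw with ℕ.m≤n⇒m<n∨m≡n (ℕ.s≤s⁻¹ n<L)
  ... | inj₁ n<L  = ∈-++⁺ˡ (∈-wordsBelow⁺ L n<L pw)
  ... | inj₂ refl = ∈-++⁺ʳ (wordsBelow L) (∈-map⁺ (L ,_) (∈-filter⁺ (λ π → P? (n , π)) (∈-allVecs n n π) pw))

  ∈-wordsBelow⁻ : ∀ L {w} → w ∈ wordsBelow L → proj₁ w ℕ.< L × P w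
  ∈-wordsBelow⁻ (suc L) w∈ with ∈-++⁻ (wordsBelow L) w∈
  ... | inj₁ w∈ˡ = let n<L , pw = ∈-wordsBelow⁻ L w∈ˡ in ℕ.m≤n⇒m≤1+n n<L , pw
  ... | inj₂ w∈ʳ with π , π∈ , refl ← ∈-map⁻ (L ,_) w∈ʳ =
    ℕ.≤-refl , proj₂ (∈-filter⁻ (λ π → P? (L , π)) {xs = allVecs L L} π∈)

  wordsBelow-unique : ∀ L → Unique (wordsBelow L)
  wordsBelow-unique zero    = []
  wordsBelow-unique (suc L) = Unique.++⁺ (wordsBelow-unique L)
    (Unique.map⁺ (λ { refl → refl }) (Unique.filter⁺ (λ π → P? (L , π)) (allVecs-unique L L)))
    λ { (w∈ˡ , w∈ʳ) → disjoint w∈ˡ (∈-map⁻ (L ,_) w∈ʳ) }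
    where
    disjoint : ∀ {w} → w ∈ wordsBelow L → ¬ (∃[ π ] (π ∈ wordsOf L × w ≡ (L , π)))
    disjoint w∈ˡ (π , _ , refl) = ℕ.<-irrefl refl (proj₁ (∈-wordsBelow⁻ L w∈ˡ))

IsCell : Class → ℕ → AnyWord → Set
IsCell κ c (n , π) = IsConnectingCell κ c π

isCell? : ∀ κ c → Decidable (IsCell κ c)
isCell? κ c (n , π) = isConnectingCell? κ c π

cellsBelow : Class → ℕ → ℕ → List AnyWord
cellsBelow κ c = wordsBelow (isCell? κ c)

IsClassMember : Class → AnyWord → Set
IsClassMember κ (n , π) = IsPermutation π × Avoids κ π

isClassMember? : ∀ κ → Decidable (IsClassMember κ)
isClassMember? κ (n , π) = isPermutation? π ×-dec avoids? κ π

membersBelow : Class → ℕ → List AnyWord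
membersBelow κ = wordsBelow (isClassMember? κ)

sizes : AnyWord → List ℕ
sizes (n , π) = componentSizes π

ε : AnyWord
ε = 0 , []

ε-member : ∀ κ → IsClassMember κ ε
ε-member av213 = (λ ()) , λ ()
ε-member av132 = (λ ()) , λ ()

-- A view of class members. The equation for sizes drives inductions on the number of components;
-- the positive size of σ makes τ strictly shorter than the whole.
data FirstComponent (κ : Class) : AnyWord → Set where
  none  : FirstComponent κ ε
  first : ∀ σ τ → IsCell κ 1 σ → 0 ℕ.< proj₁ σ → IsClassMember κ τ →
    sizes (σ ⊞ τ) ≡ proj₁ σ ∷ sizes τ → FirstComponent κ (σ ⊞ τ)

firstComponent : ∀ κ π → IsClassMember κ π → FirstComponent κ π
firstComponent κ (zero , []) _ = none
firstComponent κ (suc n , π) (perm , av) with first-component π perm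
... | k , m , σ , τ , indec , refl = first (suc k , σ) (m , τ)
  (embed-perm (⊖-embedsˡ σ τ) perm , embed-avoids (⊖-embedsˡ σ τ) κ av ,
    cong length (indecomposable⇒ σ indec))
  (ℕ.s≤s ℕ.z≤n)
  (embed-perm (⊖-embedsʳ σ τ) perm , embed-avoids (⊖-embedsʳ σ τ) κ av)
  (componentSizes-⊖ σ τ indec)

sizes-⊞ : ∀ κ σ τ → IsCell κ 1 σ → sizes (σ ⊞ τ) ≡ proj₁ σ ∷ sizes τ
sizes-⊞ κ (k , σ) (m , τ) (_ , _ , len) = componentSizes-⊖ σ τ (⇒indecomposable σ len)

⊞-cell : ∀ κ c σ τ → IsCell κ 1 σ → IsCell κ c τ → IsCell κ (suc c) (σ ⊞ τ)
⊞-cell κ c σ@(_ , s) τ@(_ , t) cellσ@(permσ , avσ , _) (permτ , avτ , lenτ) =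
  ⊖-perm s t permσ permτ , ⊖-avoids κ s t avσ avτ ,
  trans (cong length (sizes-⊞ κ σ τ cellσ)) (cong suc lenτ)

word-injective : ∀ {n} {u v : Word n} → _≡_ {A = AnyWord} (n , u) (n , v) → u ≡ v
word-injective refl = refl

-- The first entry of the component sizes is the length of the first summand, so the lengths agree,
-- and then the entries can be read off.
⊞-injective : ∀ κ {σ τ σ′ τ′} → IsCell κ 1 σ → IsCell κ 1 σ′ → σ ⊞ τ ≡ σ′ ⊞ τ′ → (σ , τ) ≡ (σ′ , τ′)
⊞-injective κ {σ@(k , s)} {τ@(m , t)} {σ′@(k′ , s′)} {τ′@(m′ , t′)} cell cell′ eq
  with refl ← List.∷-injectiveˡ (trans (sym (sizes-⊞ κ σ τ cell))
                (trans (cong sizes eq) (sizes-⊞ κ σ′ τ′ cell′)))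
  with refl ← ℕ.+-cancelˡ-≡ k m m′ (cong proj₁ eq)
  with same ← word-injective eq =
  cong₂ (λ s t → (k , s) , (m , t)) (⊖-injectiveˡ s s′ t t′ same) (⊖-injectiveʳ s s′ t t′ same)

sum-sizes : ∀ κ c π → IsCell κ c π → sum (sizes π) ≡ proj₁ π
sum-sizes κ c π (perm , av , len) with firstComponent κ π (perm , av)
... | none = refl
... | first σ τ cellσ 0<σ memτ eq with c
...   | zero  with () ← trans (sym (cong length eq)) len
...   | suc c = trans (cong sum eq) (cong (proj₁ σ ℕ.+_) (sum-sizes κ c τ
  (proj₁ memτ , proj₂ memτ , ℕ.suc-injective (trans (sym (cong length eq)) len))))

cellSum : Class → ℕ → ℕ → ℚ → (List ℕ → ℚ) → ℚ
cellSum κ c L x F = ∑ (cellsBelow κ c L) (λ τ → pow x (proj₁ τ) * F (sizes τ))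

module _ (κ : Class) {x : ℚ} (0≤x : 0ℚ ≤ x) where

  private
    0≤pow : ∀ n → 0ℚ ≤ pow x n
    0≤pow = pow-nonNeg 0≤x

  pairSum : ∀ L c M (F : List ℕ → ℚ) → ∑ (cartesianProduct (cellsBelow κ 1 L) (cellsBelow κ c M))
      (λ (σ , τ) → pow x (proj₁ σ ℕ.+ proj₁ τ) * F (proj₁ σ ∷ sizes τ)) ≡
    ∑ (cellsBelow κ 1 L) (λ σ → pow x (proj₁ σ) * cellSum κ c M x (λ w → F (proj₁ σ ∷ w)))
  pairSum L c M F = trans
    (∑-cartesianProduct (λ (σ , τ) → pow x (proj₁ σ ℕ.+ proj₁ τ) * F (proj₁ σ ∷ sizes τ))
      (cellsBelow κ 1 L) (cellsBelow κ c M))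
    (∑-cong (cellsBelow κ 1 L) λ {σ} _ →
      trans (∑-cong (cellsBelow κ c M) λ {τ} _ →
          trans (cong (_* F (proj₁ σ ∷ sizes τ)) (pow-+ x (proj₁ σ) (proj₁ τ)))
            (ℚ.*-assoc (pow x (proj₁ σ)) (pow x (proj₁ τ)) (F (proj₁ σ ∷ sizes τ))))
        (∑-*ˡ (pow x (proj₁ σ)) (λ τ → pow x (proj₁ τ) * F (proj₁ σ ∷ sizes τ)) (cellsBelow κ c M)))

  -- A cell of size below L has all its components below L. The converse fails in general, so the
  -- reverse comparison needs a larger truncation of the cells.
  cellSum≤box : ∀ c L {F} → (∀ w → 0ℚ ≤ F w) →
    cellSum κ c L x F ≤ box (cellsBelow κ 1 L) x c F
  cellSum≤box zero L {F} 0≤F = begin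
    cellSum κ 0 L x F
      ≤⟨ ∑-matching _≡_ (λ p q → trans p (sym q)) (ε ∷ []) (λ τ → pow x (proj₁ τ) * F (sizes τ)) (λ τ → pow x (proj₁ τ) * F (sizes τ))
           (wordsBelow-unique (isCell? κ 0) L) (λ π∈ → ε , here refl , only _ (proj₂ (∈-wordsBelow⁻ (isCell? κ 0) L π∈)))
           (λ { refl → ℚ.≤-refl }) (λ τ → 0≤* (0≤pow (proj₁ τ)) (0≤F (sizes τ))) ⟩
    1ℚ * F [] + 0ℚ
      ≡⟨ trans (ℚ.+-identityʳ (1ℚ * F [])) (ℚ.*-identityˡ (F [])) ⟩
    F [] ∎
    where
    open ℚ.≤-Reasoning
    only : ∀ π → IsCell κ 0 π → π ≡ ε
    only π (perm , av , len) with firstComponent κ π (perm , av)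
    ... | none = refl
    ... | first σ τ _ _ _ eq with () ← trans (sym (cong length eq)) len
  cellSum≤box (suc c) L {F} 0≤F = begin
    cellSum κ (suc c) L x F
      ≤⟨ ∑-matching (λ π (σ , τ) → σ ⊞ τ ≡ π × sizes π ≡ proj₁ σ ∷ sizes τ)
           (λ (p , _) (q , _) → trans (sym p) q)
           (cartesianProduct (cellsBelow κ 1 L) (cellsBelow κ c L))
           (λ π → pow x (proj₁ π) * F (sizes π))
           (λ (σ , τ) → pow x (proj₁ σ ℕ.+ proj₁ τ) * F (proj₁ σ ∷ sizes τ))
           (wordsBelow-unique (isCell? κ (suc c)) L) partner
           (λ { {π} (refl , eq) → ℚ.≤-reflexive (cong (λ w → pow x (proj₁ π) * F w) eq) })
           (λ (σ , τ) → 0≤* (0≤pow (proj₁ σ ℕ.+ proj₁ τ)) (0≤F (proj₁ σ ∷ sizes τ))) ⟩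
    _
      ≡⟨ pairSum L c L F ⟩
    ∑ (cellsBelow κ 1 L) (λ σ → pow x (proj₁ σ) * cellSum κ c L x (λ w → F (proj₁ σ ∷ w)))
      ≤⟨ ∑-mono (cellsBelow κ 1 L) (λ {σ} _ → *-monoʳ-nonNeg (pow x (proj₁ σ)) (0≤pow (proj₁ σ))
           (cellSum≤box c L {λ w → F (proj₁ σ ∷ w)} (λ w → 0≤F (proj₁ σ ∷ w)))) ⟩
    box (cellsBelow κ 1 L) x (suc c) F ∎
    where
    open ℚ.≤-Reasoning
    partner : ∀ {π} → π ∈ cellsBelow κ (suc c) L →
      ∃[ στ ] στ ∈ cartesianProduct (cellsBelow κ 1 L) (cellsBelow κ c L) ×
        proj₁ στ ⊞ proj₂ στ ≡ π × sizes π ≡ proj₁ (proj₁ στ) ∷ sizes (proj₂ στ)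
    partner {π} π∈ with ∈-wordsBelow⁻ (isCell? κ (suc c)) L π∈
    ... | n<L , perm , av , len with firstComponent κ π (perm , av)
    ... | none with () ← len
    ... | first σ τ cellσ _ (permτ , avτ) eq = (σ , τ) ,
      ∈-cartesianProduct⁺
        (∈-wordsBelow⁺ (isCell? κ 1) L (ℕ.≤-<-trans (ℕ.m≤m+n (proj₁ σ) (proj₁ τ)) n<L) cellσ)
        (∈-wordsBelow⁺ (isCell? κ c) L (ℕ.≤-<-trans (ℕ.m≤n+m (proj₁ τ) (proj₁ σ)) n<L)
          (permτ , avτ , ℕ.suc-injective (trans (sym (cong length eq)) len))) ,
      refl , eq

  -- Sizes below L add up to at most c L. The extra 1 makes room for the empty cell at c = 0, where
  -- the induction starts.
  box≤cellSum : ∀ c L {F} → (∀ w → 0ℚ ≤ F w) →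
    box (cellsBelow κ 1 L) x c F ≤ cellSum κ c (suc (c ℕ.* L)) x F
  box≤cellSum zero L {F} 0≤F = begin
    F []
      ≡⟨ sym (trans (ℚ.+-identityʳ (1ℚ * F [])) (ℚ.*-identityˡ (F []))) ⟩
    1ℚ * F [] + 0ℚ
      ≤⟨ ∑-matching _≡_ (λ p q → trans p (sym q)) (cellsBelow κ 0 1)
           (λ τ → pow x (proj₁ τ) * F (sizes τ)) (λ τ → pow x (proj₁ τ) * F (sizes τ))
           (All.[] ∷ []) (λ { (here refl) → ε , ∈-wordsBelow⁺ (isCell? κ 0) 1 (ℕ.s≤s ℕ.z≤n)
             (proj₁ (ε-member κ) , proj₂ (ε-member κ) , refl) , refl })
           (λ { refl → ℚ.≤-refl }) (λ τ → 0≤* (0≤pow (proj₁ τ)) (0≤F (sizes τ))) ⟩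
    cellSum κ 0 1 x F ∎
    where open ℚ.≤-Reasoning
  box≤cellSum (suc c) L {F} 0≤F = begin
    box (cellsBelow κ 1 L) x (suc c) F
      ≤⟨ ∑-mono (cellsBelow κ 1 L) (λ {σ} _ → *-monoʳ-nonNeg (pow x (proj₁ σ)) (0≤pow (proj₁ σ))
           (box≤cellSum c L {λ w → F (proj₁ σ ∷ w)} (λ w → 0≤F (proj₁ σ ∷ w)))) ⟩
    ∑ (cellsBelow κ 1 L) (λ σ → pow x (proj₁ σ) * cellSum κ c M x (λ w → F (proj₁ σ ∷ w)))
      ≡⟨ sym (pairSum L c M F) ⟩
    _
      ≤⟨ ∑-matching (λ (σ , τ) π → IsCell κ 1 σ × σ ⊞ τ ≡ π)
           (λ { (cell , refl) (cell′ , eq) → ⊞-injective κ cell cell′ (sym eq) })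
           (cellsBelow κ (suc c) (suc (L ℕ.+ c ℕ.* L)))
           (λ (σ , τ) → pow x (proj₁ σ ℕ.+ proj₁ τ) * F (proj₁ σ ∷ sizes τ))
           (λ π → pow x (proj₁ π) * F (sizes π))
           (Unique.cartesianProduct⁺ (wordsBelow-unique (isCell? κ 1) L) (wordsBelow-unique (isCell? κ c) M))
           partner
           (λ { {σ , τ} (cell , refl) → ℚ.≤-reflexive (cong (λ w → pow x (proj₁ σ ℕ.+ proj₁ τ) * F w) (sym (sizes-⊞ κ σ τ cell))) })
           (λ π → 0≤* (0≤pow (proj₁ π)) (0≤F (sizes π))) ⟩
    cellSum κ (suc c) (suc (suc c ℕ.* L)) x F ∎
    where
    open ℚ.≤-Reasoning
    M = suc (c ℕ.* L)
    partner : ∀ {στ} → στ ∈ cartesianProduct (cellsBelow κ 1 L) (cellsBelow κ c M) →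
      ∃[ π ] π ∈ cellsBelow κ (suc c) (suc (L ℕ.+ c ℕ.* L)) × IsCell κ 1 (proj₁ στ) × proj₁ στ ⊞ proj₂ στ ≡ π
    partner {σ , τ} στ∈ =
      let σ∈ , τ∈ = ∈-cartesianProduct⁻ (cellsBelow κ 1 L) (cellsBelow κ c M) στ∈
          σ<L , cellσ = ∈-wordsBelow⁻ (isCell? κ 1) L σ∈
          τ<M , cellτ = ∈-wordsBelow⁻ (isCell? κ c) M τ∈
      in σ ⊞ τ , ∈-wordsBelow⁺ (isCell? κ (suc c)) (suc (suc c ℕ.* L)) (ℕ.s≤s (ℕ.+-mono-≤ (ℕ.<⇒≤ σ<L) (ℕ.s≤s⁻¹ τ<M)))
        (⊞-cell κ c σ τ cellσ cellτ) , cellσ , refl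

-- A quadratic recursion bounding the indecomposables

-- Iterates of q ↦ x + q² from 0; they increase to the smaller root of q = x + q².
iterate : ℚ → ℕ → ℚ
iterate x zero    = 0ℚ
iterate x (suc n) = x + iterate x n * iterate x n

module _ (κ : Class) {x : ℚ} (0≤x : 0ℚ ≤ x) where

  private
    0≤pow : ∀ n → 0ℚ ≤ pow x n
    0≤pow = pow-nonNeg 0≤x
    pow-proj : AnyWord → ℚ
    pow-proj π = pow x (proj₁ π)

  indecomposables≤members : ∀ L →
    weight (cellsBelow κ 1 (suc L)) x ≤ x * weight (membersBelow κ L) x
  indecomposables≤members L = begin
    weight (cellsBelow κ 1 (suc L)) x
      ≤⟨ ∑-matching R inj (membersBelow κ L) pow-proj (λ τ → x * pow x (proj₁ τ))
           (wordsBelow-unique (isCell? κ 1) (suc L)) partner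
           (λ { refl → ℚ.≤-refl }) (λ τ → 0≤* 0≤x (0≤pow (proj₁ τ))) ⟩
    ∑ (membersBelow κ L) (λ τ → x * pow x (proj₁ τ))
      ≡⟨ ∑-*ˡ x pow-proj (membersBelow κ L) ⟩
    x * weight (membersBelow κ L) x ∎
    where
    open ℚ.≤-Reasoning
    R : AnyWord → AnyWord → Set
    R π (n , τ) = (suc n , extend κ τ) ≡ π
    inj : ∀ {π π′ τ} → R π τ → R π′ τ → π ≡ π′
    inj p q = trans (sym p) q
    partner : ∀ {π} → π ∈ cellsBelow κ 1 (suc L) → ∃[ τ ] τ ∈ membersBelow κ L × R π τ
    partner {n , π} π∈ with ∈-wordsBelow⁻ (isCell? κ 1) (suc L) π∈
    partner {zero  , π} π∈ | _ , _ , _ , ()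
    partner {suc n , π} π∈ | n<L , perm , av , len
      with τ , refl ← indecomposable-extend κ π perm av (⇒indecomposable π len) =
      (n , τ) , ∈-wordsBelow⁺ (isClassMember? κ) L (ℕ.s<s⁻¹ n<L)
        (embed-perm (extend-embeds κ τ) perm , embed-avoids (extend-embeds κ τ) κ av) , refl

  -- `nothing` stands for the empty word. In the other members the first component has at least one
  -- point, which lowers the truncation of the rest to L.
  members≤ : ∀ L → weight (membersBelow κ (suc L)) x ≤
    1ℚ + weight (cellsBelow κ 1 (suc L)) x * weight (membersBelow κ L) x
  members≤ L = begin
    weight (membersBelow κ (suc L)) x
      ≤⟨ ∑-matching R inj (nothing ∷ List.map just pairs) pow-proj u
           (wordsBelow-unique (isClassMember? κ) (suc L)) partner
           R⇒≤ u-nonNeg ⟩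
    1ℚ + ∑ (List.map just pairs) u
      ≡⟨ cong (1ℚ +_) (trans (∑-map just u pairs)
           (trans (∑-cartesianProduct (λ (σ , τ) → pow x (proj₁ σ ℕ.+ proj₁ τ)) (cellsBelow κ 1 (suc L)) (membersBelow κ L))
             (trans (∑-cong (cellsBelow κ 1 (suc L)) λ {σ} _ →
                 trans (∑-cong (membersBelow κ L) λ {τ} _ → pow-+ x (proj₁ σ) (proj₁ τ))
                   (∑-*ˡ (pow x (proj₁ σ)) pow-proj (membersBelow κ L)))
               (∑-*ʳ (weight (membersBelow κ L) x) pow-proj (cellsBelow κ 1 (suc L)))))) ⟩
    1ℚ + weight (cellsBelow κ 1 (suc L)) x * weight (membersBelow κ L) x ∎
    where
    open ℚ.≤-Reasoning
    pairs : List (AnyWord × AnyWord)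
    pairs = cartesianProduct (cellsBelow κ 1 (suc L)) (membersBelow κ L)
    glue : Maybe (AnyWord × AnyWord) → AnyWord
    glue nothing        = ε
    glue (just (σ , τ)) = σ ⊞ τ
    R : AnyWord → Maybe (AnyWord × AnyWord) → Set
    R π y = glue y ≡ π
    inj : ∀ {π π′ y} → R π y → R π′ y → π ≡ π′
    inj p q = trans (sym p) q
    u : Maybe (AnyWord × AnyWord) → ℚ
    u y = pow x (proj₁ (glue y))
    R⇒≤ : ∀ {π y} → R π y → pow x (proj₁ π) ≤ u y
    R⇒≤ refl = ℚ.≤-refl
    u-nonNeg : ∀ y → 0ℚ ≤ u y
    u-nonNeg y = 0≤pow (proj₁ (glue y))
    partner : ∀ {π} → π ∈ membersBelow κ (suc L) → ∃[ y ] y ∈ nothing ∷ List.map just pairs × R π y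
    partner {π} π∈ with ∈-wordsBelow⁻ (isClassMember? κ) (suc L) π∈
    ... | n<L , mem with firstComponent κ π mem
    ... | none = nothing , here refl , refl
    ... | first σ τ cellσ 0<σ memτ _ = just (σ , τ) ,
      there (∈-map⁺ just (∈-cartesianProduct⁺
        (∈-wordsBelow⁺ (isCell? κ 1) (suc L) (ℕ.≤-<-trans (ℕ.m≤m+n (proj₁ σ) (proj₁ τ)) n<L) cellσ)
        (∈-wordsBelow⁺ (isClassMember? κ) L
          (ℕ.s≤s⁻¹ (ℕ.≤-trans (ℕ.s≤s (ℕ.+-monoˡ-≤ (proj₁ τ) 0<σ)) n<L)) memτ))) ,
      refl

  -- Put q = x A for the truncated series A of the members. The two preceding bounds combine so that
  -- the next q is at most x + q².
  members≤iterate : ∀ L → x * weight (membersBelow κ L) x ≤ iterate x L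
  members≤iterate zero    = ℚ.≤-reflexive (ℚ.*-zeroʳ x)
  members≤iterate (suc L) = begin
    x * weight (membersBelow κ (suc L)) x
      ≤⟨ *-monoʳ-nonNeg x 0≤x (members≤ L) ⟩
    x * (1ℚ + weight (cellsBelow κ 1 (suc L)) x * A)
      ≤⟨ *-monoʳ-nonNeg x 0≤x (ℚ.+-monoʳ-≤ 1ℚ (*-monoˡ-nonNeg A 0≤A (indecomposables≤members L))) ⟩
    x * (1ℚ + x * A * A)
      ≡⟨ expand x A ⟩
    x + x * A * (x * A)
      ≤⟨ ℚ.+-monoʳ-≤ x (ℚ.≤-trans (*-monoʳ-nonNeg (x * A) (0≤* 0≤x 0≤A) (members≤iterate L))
           (*-monoˡ-nonNeg (iterate x L) (ℚ.≤-trans (0≤* 0≤x 0≤A) (members≤iterate L)) (members≤iterate L))) ⟩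
    x + iterate x L * iterate x L ∎
    where
    open ℚ.≤-Reasoning
    A = weight (membersBelow κ L) x
    0≤A : 0ℚ ≤ A
    0≤A = weight-nonNeg (membersBelow κ L) 0≤x
    expand : ∀ x A → x * (1ℚ + x * A * A) ≡ x + x * A * (x * A)
    expand = solve-∀ ring

  weight≤iterate : ∀ L → weight (cellsBelow κ 1 L) x ≤ iterate x L
  weight≤iterate L = begin
    weight (cellsBelow κ 1 L) x
      ≡⟨ sym (ℚ.+-identityʳ (weight (cellsBelow κ 1 L) x)) ⟩
    weight (cellsBelow κ 1 L) x + 0ℚ
      ≤⟨ ℚ.+-monoʳ-≤ (weight (cellsBelow κ 1 L) x) (∑-nonNeg {f = pow-proj} (List.map (L ,_) (wordsOf (isCell? κ 1) L)) (λ π → 0≤pow (proj₁ π))) ⟩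
    weight (cellsBelow κ 1 L) x + ∑ (List.map (L ,_) (wordsOf (isCell? κ 1) L)) pow-proj
      ≡⟨ sym (∑-++ pow-proj (cellsBelow κ 1 L) (List.map (L ,_) (wordsOf (isCell? κ 1) L))) ⟩
    weight (cellsBelow κ 1 (suc L)) x
      ≤⟨ indecomposables≤members L ⟩
    x * weight (membersBelow κ L) x
      ≤⟨ members≤iterate L ⟩
    iterate x L ∎
    where open ℚ.≤-Reasoning

  correlation : ∀ c L {F G} → (∀ w → 0ℚ ≤ F w) → (∀ w → 0ℚ ≤ G w) → Increasing F → Increasing G →
    cellSum κ c L x F * cellSum κ c L x G ≤
    pow (iterate x L) c * cellSum κ c (suc (c ℕ.* L)) x (λ w → F w * G w)
  correlation c L {F} {G} 0≤F 0≤G mono-F mono-G = begin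
    cellSum κ c L x F * cellSum κ c L x G
      ≤⟨ *-monoˡ-nonNeg _ (∑-nonNeg (cellsBelow κ c L) (λ τ → 0≤* (0≤pow (proj₁ τ)) (0≤G (sizes τ))))
           (cellSum≤box κ 0≤x c L 0≤F) ⟩
    box X x c F * cellSum κ c L x G
      ≤⟨ *-monoʳ-nonNeg _ (box-nonNeg X 0≤x c 0≤F) (cellSum≤box κ 0≤x c L 0≤G) ⟩
    box X x c F * box X x c G
      ≤⟨ harris X 0≤x c mono-F mono-G ⟩
    pow (weight X x) c * box X x c (λ w → F w * G w)
      ≤⟨ *-monoˡ-nonNeg _ (box-nonNeg X 0≤x c 0≤FG)
           (pow-mono (weight-nonNeg X 0≤x) (weight≤iterate L) c) ⟩
    pow (iterate x L) c * box X x c (λ w → F w * G w)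
      ≤⟨ *-monoʳ-nonNeg _ (pow-nonNeg (ℚ.≤-trans (weight-nonNeg X 0≤x) (weight≤iterate L)) c)
           (box≤cellSum κ 0≤x c L 0≤FG) ⟩
    pow (iterate x L) c * cellSum κ c (suc (c ℕ.* L)) x (λ w → F w * G w) ∎
    where
    open ℚ.≤-Reasoning
    X = cellsBelow κ 1 L
    0≤FG : ∀ w → 0ℚ ≤ F w * G w
    0≤FG w = 0≤* (0≤F w) (0≤G w)

-- Rational series

nat : ℕ → ℚ
nat n = ℤ.+ n ℚ./ 1

toℚᵘ-nat : ∀ n → toℚᵘ (nat n) ℚᵘ.≃ mkℚᵘ (ℤ.+ n) 0
toℚᵘ-nat n = ℚ.toℚᵘ-fromℚᵘ (mkℚᵘ (ℤ.+ n) 0)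

nat-mono : ∀ {m n} → m ℕ.≤ n → nat m ≤ nat n
nat-mono {m} {n} m≤n = ℚ.toℚᵘ-cancel-≤ (ℚᵘ.≤-respˡ-≃ (ℚᵘ.≃-sym (toℚᵘ-nat m))
  (ℚᵘ.≤-respʳ-≃ (ℚᵘ.≃-sym (toℚᵘ-nat n))
    (*≤* (ℤ.*-monoʳ-≤-nonNeg (ℤ.+ 1) (ℤ.+≤+ m≤n)))))

nat-nonNeg : ∀ n → 0ℚ ≤ nat n
nat-nonNeg n = nat-mono (ℕ.z≤n {n})

nat-+ : ∀ m n → nat (m ℕ.+ n) ≡ nat m + nat n
nat-+ m n = ℚ.toℚᵘ-injective (ℚᵘ.≃-trans (toℚᵘ-nat (m ℕ.+ n)) (ℚᵘ.≃-trans
  (*≡* (cong (λ k → k ℤ.* ℤ.+ 1) (sym (cong₂ ℤ._+_ (ℤ.*-identityʳ (ℤ.+ m)) (ℤ.*-identityʳ (ℤ.+ n))))))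
  (ℚᵘ.≃-sym (ℚᵘ.≃-trans (ℚ.toℚᵘ-homo-+ (nat m) (nat n)) (ℚᵘ.+-cong (toℚᵘ-nat m) (toℚᵘ-nat n))))))

nat-* : ∀ m n → nat (m ℕ.* n) ≡ nat m * nat n
nat-* m n = ℚ.toℚᵘ-injective (ℚᵘ.≃-trans (toℚᵘ-nat (m ℕ.* n)) (ℚᵘ.≃-trans
  (*≡* (cong (λ k → k ℤ.* ℤ.+ 1) (ℤ.pos-* m n)))
  (ℚᵘ.≃-sym (ℚᵘ.≃-trans (ℚ.toℚᵘ-homo-* (nat m) (nat n)) (ℚᵘ.*-cong (toℚᵘ-nat m) (toℚᵘ-nat n))))))

nat-suc : ∀ n → nat (suc n) ≡ 1ℚ + nat n
nat-suc n = nat-+ 1 n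

nat-^ : ∀ m d → nat (m ℕ.^ d) ≡ pow (nat m) d
nat-^ m zero    = refl
nat-^ m (suc d) = trans (nat-* m (m ℕ.^ d)) (cong (nat m *_) (nat-^ m d))

archimedean : ∀ p → ∃[ n ] p ≤ nat n
archimedean p@(mkℚ num d-1 _) = ℤ.∣ num ∣ , ℚ.toℚᵘ-cancel-≤
  (ℚᵘ.≤-respʳ-≃ (ℚᵘ.≃-sym (toℚᵘ-nat ℤ.∣ num ∣)) (*≤* (begin
    num ℤ.* ℤ.+ 1               ≡⟨ ℤ.*-identityʳ num ⟩
    num                       ≤⟨ i≤∣i∣ num ⟩
    ℤ.+ ℤ.∣ num ∣               ≤⟨ ℤ.+≤+ (ℕ.m≤m*n ℤ.∣ num ∣ (suc d-1)) ⟩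
    ℤ.+ (ℤ.∣ num ∣ ℕ.* suc d-1) ≡⟨ ℤ.pos-* ℤ.∣ num ∣ (suc d-1) ⟩
    ℤ.+ ℤ.∣ num ∣ ℤ.* ℤ.+ suc d-1 ∎)))
  where
  open ℤ.≤-Reasoning
  i≤∣i∣ : ∀ i → i ℤ.≤ ℤ.+ ℤ.∣ i ∣
  i≤∣i∣ (ℤ.+ n)       = ℤ.≤-refl
  i≤∣i∣ ℤ.-[1+ n ] = ℤ.-≤+

Vanishing : (ℕ → ℚ) → Set
Vanishing e = ∀ ε → 0ℚ < ε → Eventually (λ n → e n ≤ ε)

gap-< : ∀ {p q} → p < q → 0ℚ < q - p
gap-< {p} {q} p<q = subst (_< q - p) (ℚ.+-inverseʳ p) (ℚ.+-monoˡ-< (- p) p<q)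

module _ {θ : ℚ} (0≤θ : 0ℚ ≤ θ) (θ<1 : θ < 1ℚ) where

  private
    0<1-θ : 0ℚ < 1ℚ - θ
    0<1-θ = gap-< θ<1
    0≤1-θ : 0ℚ ≤ 1ℚ - θ
    0≤1-θ = ℚ.<⇒≤ 0<1-θ
    0≤θⁿ : ∀ n → 0ℚ ≤ pow θ n
    0≤θⁿ = pow-nonNeg 0≤θ
    θⁿ≤1 : ∀ n → pow θ n ≤ 1ℚ
    θⁿ≤1 = pow-≤1 0≤θ (ℚ.<⇒≤ θ<1)

  -- 1 - θⁿ is 1 - θ times the sum of the first n powers of θ, each of which is at least θⁿ. This
  -- gives decay of order 1/n without logarithms.
  n[1-θ]θⁿ≤ : ∀ n → nat n * ((1ℚ - θ) * pow θ n) ≤ 1ℚ - pow θ n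
  n[1-θ]θⁿ≤ zero    = ℚ.≤-reflexive (ℚ.*-zeroˡ ((1ℚ - θ) * 1ℚ))
  n[1-θ]θⁿ≤ (suc n) = begin
    nat (suc n) * ((1ℚ - θ) * (θ * T))
      ≡⟨ trans (cong (_* ((1ℚ - θ) * (θ * T))) (nat-suc n)) (expand (nat n) θ T) ⟩
    θ * (nat n * ((1ℚ - θ) * T)) + (1ℚ - θ) * (θ * T)
      ≤⟨ ℚ.+-mono-≤ (*-monoʳ-nonNeg θ 0≤θ (n[1-θ]θⁿ≤ n)) (*-monoʳ-nonNeg (1ℚ - θ) 0≤1-θ (θⁿ≤1 (suc n))) ⟩
    θ * (1ℚ - T) + (1ℚ - θ) * 1ℚ
      ≡⟨ collect θ T ⟩
    1ℚ - θ * T ∎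
    where
    open ℚ.≤-Reasoning
    T = pow θ n
    expand : ∀ n θ T → (1ℚ + n) * ((1ℚ - θ) * (θ * T)) ≡ θ * (n * ((1ℚ - θ) * T)) + (1ℚ - θ) * (θ * T)
    expand = solve-∀ ring
    collect : ∀ θ T → θ * (1ℚ - T) + (1ℚ - θ) * 1ℚ ≡ 1ℚ - θ * T
    collect = solve-∀ ring

  geometric-vanishing : ∀ K → Vanishing (λ n → K * pow θ n)
  geometric-vanishing K ε 0<ε = n₀ , λ n n₀≤n → begin
    K * pow θ n
      ≡⟨ cong (_* pow θ n) (sym (trans (ℚ.*-assoc K (inv u 0<u) u)
           (trans (cong (K *_) (trans (ℚ.*-comm (inv u 0<u) u) (*-inv u 0<u))) (ℚ.*-identityʳ K)))) ⟩
    K * inv u 0<u * u * pow θ n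
      ≤⟨ *-monoˡ-nonNeg (pow θ n) (0≤θⁿ n) (*-monoˡ-nonNeg u (ℚ.<⇒≤ 0<u) (ℚ.≤-trans K/u≤n₀ (nat-mono n₀≤n))) ⟩
    nat n * (ε * (1ℚ - θ)) * pow θ n
      ≡⟨ regroup (nat n) ε (1ℚ - θ) (pow θ n) ⟩
    ε * (nat n * ((1ℚ - θ) * pow θ n))
      ≤⟨ *-monoʳ-nonNeg ε (ℚ.<⇒≤ 0<ε) (ℚ.≤-trans (n[1-θ]θⁿ≤ n)
           (≤-by-gap (pow θ n) (0≤θⁿ n) (complement (pow θ n)))) ⟩
    ε * 1ℚ
      ≡⟨ ℚ.*-identityʳ ε ⟩
    ε ∎
    where
    open ℚ.≤-Reasoning
    -- n₀ is at least K / u, so from n₀ on K θⁿ is at most ε times the left-hand side of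
    -- `n[1-θ]θⁿ≤`.
    u = ε * (1ℚ - θ)
    0<u : 0ℚ < u
    0<u = *-pos ε (1ℚ - θ) 0<ε 0<1-θ
    n₀ = proj₁ (archimedean (K * inv u 0<u))
    K/u≤n₀ = proj₂ (archimedean (K * inv u 0<u))
    regroup : ∀ n ε d T → n * (ε * d) * T ≡ ε * (n * (d * T))
    regroup = solve-∀ ring
    complement : ∀ T → 1ℚ ≡ 1ℚ - T + T
    complement = solve-∀ ring

bernoulli : ∀ {δ} → 0ℚ ≤ δ → ∀ n → 1ℚ + nat n * δ ≤ pow (1ℚ + δ) n
bernoulli {δ} 0≤δ zero    = ℚ.≤-reflexive (trans (cong (1ℚ +_) (ℚ.*-zeroˡ δ)) (ℚ.+-identityʳ 1ℚ))
bernoulli {δ} 0≤δ (suc n) = begin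
  1ℚ + nat (suc n) * δ
    ≤⟨ ≤-by-gap (δ * (nat n * δ)) (0≤* 0≤δ (0≤* (nat-nonNeg n) 0≤δ))
         (sym (trans (cong (λ m → 1ℚ + m * δ + δ * (nat n * δ)) (nat-suc n)) (expand δ (nat n)))) ⟩
  (1ℚ + δ) * (1ℚ + nat n * δ)
    ≤⟨ *-monoʳ-nonNeg (1ℚ + δ) (0≤+ 0≤1 0≤δ) (bernoulli 0≤δ n) ⟩
  (1ℚ + δ) * pow (1ℚ + δ) n ∎
  where
  open ℚ.≤-Reasoning
  expand : ∀ δ n → 1ℚ + (1ℚ + n) * δ + δ * (n * δ) ≡ (1ℚ + δ) * (1ℚ + n * δ)
  expand = solve-∀ ring

-- Each factor n + 1 is absorbed by enlarging the ratio θ to θ (2 - θ) = 1 - (1 - θ)².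
polynomial×geometric : ∀ d {ρ} → 0ℚ ≤ ρ → ρ < 1ℚ →
  ∃[ K ] ∃[ θ ] 0ℚ ≤ K × 0ℚ ≤ θ × θ < 1ℚ ×
    (∀ n → pow (nat (suc n)) d * pow ρ n ≤ K * pow θ n)
polynomial×geometric zero    {ρ} 0≤ρ ρ<1 = 1ℚ , ρ , 0≤1 , 0≤ρ , ρ<1 , λ n → ℚ.≤-refl
polynomial×geometric (suc d) {ρ} 0≤ρ ρ<1 with polynomial×geometric d 0≤ρ ρ<1
... | K , θ , 0≤K , 0≤θ , θ<1 , bound =
  K * inv δ 0<δ , θ * (1ℚ + δ) , 0≤* 0≤K 0≤1/δ , 0≤* 0≤θ (0≤+ 0≤1 0≤δ) ,
  subst₂ _<_ (ℚ.+-identityʳ θ′) (square θ) (ℚ.+-monoʳ-< θ′ (*-pos δ δ 0<δ 0<δ)) ,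
  λ n → begin
    nat (suc n) * pow (nat (suc n)) d * pow ρ n
      ≡⟨ ℚ.*-assoc (nat (suc n)) (pow (nat (suc n)) d) (pow ρ n) ⟩
    nat (suc n) * (pow (nat (suc n)) d * pow ρ n)
      ≤⟨ *-monoʳ-nonNeg (nat (suc n)) (nat-nonNeg (suc n)) (bound n) ⟩
    nat (suc n) * (K * pow θ n)
      ≡⟨ trans (sym (ℚ.*-identityˡ _)) (trans (cong (_* (nat (suc n) * (K * pow θ n))) (sym (*-inv δ 0<δ)))
           (regroup δ (inv δ 0<δ) (nat (suc n)) K (pow θ n))) ⟩
    K * inv δ 0<δ * (pow θ n * (nat (suc n) * δ))
      ≤⟨ *-monoʳ-nonNeg (K * inv δ 0<δ) (0≤* 0≤K 0≤1/δ)
           (*-monoʳ-nonNeg (pow θ n) (pow-nonNeg 0≤θ n) (ℚ.≤-trans (n+1≤ n) (bernoulli 0≤δ n))) ⟩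
    K * inv δ 0<δ * (pow θ n * pow (1ℚ + δ) n)
      ≡⟨ cong (K * inv δ 0<δ *_) (sym (pow-* θ (1ℚ + δ) n)) ⟩
    K * inv δ 0<δ * pow (θ * (1ℚ + δ)) n ∎
  where
  open ℚ.≤-Reasoning
  δ = 1ℚ - θ
  θ′ = θ * (1ℚ + δ)
  0<δ : 0ℚ < δ
  0<δ = gap-< θ<1
  0≤δ : 0ℚ ≤ δ
  0≤δ = ℚ.<⇒≤ 0<δ
  0≤1/δ : 0ℚ ≤ inv δ 0<δ
  0≤1/δ = ℚ.<⇒≤ (inv-pos δ 0<δ)
  square : ∀ θ → θ * (1ℚ + (1ℚ - θ)) + (1ℚ - θ) * (1ℚ - θ) ≡ 1ℚ
  square = solve-∀ ring
  regroup : ∀ δ i n K T → δ * i * (n * (K * T)) ≡ K * i * (T * (n * δ))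
  regroup = solve-∀ ring
  -- This holds because δ ≤ 1. With Bernoulli's inequality n + 1 is then at most (1 + δ)ⁿ / δ, the
  -- source of the new constant and the new ratio.
  n+1≤ : ∀ n → nat (suc n) * δ ≤ 1ℚ + nat n * δ
  n+1≤ n = ≤-by-gap θ 0≤θ (sym (trans (cong (λ m → m * δ + θ) (nat-suc n)) (expand θ (nat n))))
    where
    expand : ∀ θ n → (1ℚ + n) * (1ℚ - θ) + θ ≡ 1ℚ + n * (1ℚ - θ)
    expand = solve-∀ ring

-- Monotonicity with a tail bound, stated without a limit so that it can hold at each rational
-- approximation with the same e.
Bracketed : (ℕ → ℚ) → (ℕ → ℚ) → Set
Bracketed a e = ∀ n m → n ℕ.≤ m → a n ≤ a m × a m ≤ a n + e n

-- With L = K / (1 - θ), the quantity a n + L θⁿ does not increase, since L θⁿ exceeds its successor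
-- by exactly K θⁿ.
geometric-bracket : ∀ {θ} (0≤θ : 0ℚ ≤ θ) (θ<1 : θ < 1ℚ) {K} → 0ℚ ≤ K → ∀ a →
  (∀ n → a n ≤ a (suc n)) → (∀ n → a (suc n) ≤ a n + K * pow θ n) →
  Bracketed a (λ n → K * inv (1ℚ - θ) (gap-< θ<1) * pow θ n)
geometric-bracket {θ} 0≤θ θ<1 {K} 0≤K a up step n m n≤m
  with k , refl ← ℕ.m≤n⇒∃[o]m+o≡n n≤m = lower k , upper
  where
  open ℚ.≤-Reasoning
  i = inv (1ℚ - θ) (gap-< θ<1)
  L = K * i
  0≤L : 0ℚ ≤ L
  0≤L = 0≤* 0≤K (ℚ.<⇒≤ (inv-pos (1ℚ - θ) (gap-< θ<1)))
  lower : ∀ k → a n ≤ a (n ℕ.+ k)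
  lower zero    = ℚ.≤-reflexive (cong a (sym (ℕ.+-identityʳ n)))
  lower (suc k) = ℚ.≤-trans (lower k) (subst (λ l → a (n ℕ.+ k) ≤ a l) (sym (ℕ.+-suc n k)) (up (n ℕ.+ k)))
  telescope : ∀ k → a (n ℕ.+ k) + L * pow θ (n ℕ.+ k) ≤ a n + L * pow θ n
  telescope zero    = ℚ.≤-reflexive (cong (λ l → a l + L * pow θ l) (ℕ.+-identityʳ n))
  telescope (suc k) = begin
    a (n ℕ.+ suc k) + L * pow θ (n ℕ.+ suc k)
      ≡⟨ cong (λ l → a l + L * pow θ l) (ℕ.+-suc n k) ⟩
    a (suc (n ℕ.+ k)) + L * (θ * T)
      ≤⟨ ℚ.+-monoˡ-≤ (L * (θ * T)) (step (n ℕ.+ k)) ⟩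
    a (n ℕ.+ k) + K * T + L * (θ * T)
      ≡⟨ cong (λ k → k + L * (θ * T)) (cong (λ u → a (n ℕ.+ k) + u)
           (cong (_* T) (sym (trans (cong (K *_) (*-inv (1ℚ - θ) (gap-< θ<1))) (ℚ.*-identityʳ K))))) ⟩
    a (n ℕ.+ k) + K * ((1ℚ - θ) * i) * T + K * i * (θ * T)
      ≡⟨ collect (a (n ℕ.+ k)) K θ i T ⟩
    a (n ℕ.+ k) + L * T
      ≤⟨ telescope k ⟩
    a n + L * pow θ n ∎
    where
    T = pow θ (n ℕ.+ k)
    collect : ∀ a K θ i T → a + K * ((1ℚ - θ) * i) * T + K * i * (θ * T) ≡ a + K * i * T
    collect = solve-∀ ring
  upper : a (n ℕ.+ k) ≤ a n + L * pow θ n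
  upper = ℚ.≤-trans (≤-by-gap (L * pow θ (n ℕ.+ k)) (0≤* 0≤L (pow-nonNeg 0≤θ (n ℕ.+ k))) refl) (telescope k)

∣∣-≤ : ∀ {p b} → p ≤ b → - p ≤ b → ∣ p ∣ ≤ b
∣∣-≤ {p} {b} p≤b -p≤b with ℚ.∣p∣≡p∨∣p∣≡-p p
... | inj₁ eq = subst (_≤ b) (sym eq) p≤b
... | inj₂ eq = subst (_≤ b) (sym eq) -p≤b

p≤∣p∣ : ∀ p → p ≤ ∣ p ∣
p≤∣p∣ p with ℚ.∣p∣≡p∨∣p∣≡-p p
... | inj₁ eq = ℚ.≤-reflexive (sym eq)
... | inj₂ eq = ≤-by-gap (∣ p ∣ + ∣ p ∣) (0≤+ (ℚ.0≤∣p∣ p) (ℚ.0≤∣p∣ p))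
  (trans eq (trans (insert p) (cong (λ q → p + (q + q)) (sym eq))))
  where
  insert : ∀ p → - p ≡ p + (- p + - p)
  insert = solve-∀ ring

-- The limit of y n is represented by the diagonal, whose j-th term is the j-th approximation of y
-- (g j). Since e does not depend on j, late diagonal terms are all within e M of the approximations
-- of the single real y M, which is Cauchy. The choice of g stays open so that different series can
-- be truncated differently.
module _ (y : ℕ → ℝ) (e : ℕ → ℚ) (e→0 : Vanishing e) (J : ℕ)
         (bracket : ∀ j → J ℕ.≤ j → Bracketed (λ n → seq (y n) j) e)
         (g : ℕ → ℕ) (n≤gn : ∀ n → n ℕ.≤ g n) where

  diagonalSeq : ℕ → ℚ
  diagonalSeq j = seq (y (g j)) j

  diagonal-cauchy : Cauchy diagonalSeq
  diagonal-cauchy ε 0<ε with e→0 (½ * ε) (half-pos 0<ε)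
  ... | M , e≤ with cauchy (y M) (½ * ε) (half-pos 0<ε)
  ... | N′ , close = M ℕ.⊔ (J ℕ.⊔ N′) , λ m n m≥ n≥ →
    ∣∣-≤ (one-sided m n m≥ n≥) (subst (_≤ ε) (flip (diagonalSeq m) (diagonalSeq n)) (one-sided n m n≥ m≥))
    where
    flip : ∀ a b → b - a ≡ - (a - b)
    flip = solve-∀ ring
    regroup : ∀ a e b → a + e - b ≡ (a - b) + e
    regroup = solve-∀ ring
    one-sided : ∀ m n → M ℕ.⊔ (J ℕ.⊔ N′) ℕ.≤ m → M ℕ.⊔ (J ℕ.⊔ N′) ℕ.≤ n →
      diagonalSeq m - diagonalSeq n ≤ ε
    one-sided m n m≥ n≥ = begin
      diagonalSeq m - diagonalSeq n
        ≤⟨ ℚ.+-mono-≤ (proj₂ (bracket m J≤m M (g m) (ℕ.≤-trans M≤m (n≤gn m))))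
             (ℚ.neg-antimono-≤ (proj₁ (bracket n J≤n M (g n) (ℕ.≤-trans M≤n (n≤gn n))))) ⟩
      seq (y M) m + e M - seq (y M) n
        ≡⟨ regroup (seq (y M) m) (e M) (seq (y M) n) ⟩
      (seq (y M) m - seq (y M) n) + e M
        ≤⟨ ℚ.+-mono-≤ (ℚ.≤-trans (p≤∣p∣ (seq (y M) m - seq (y M) n)) (close m n N≤m N≤n)) (e≤ M ℕ.≤-refl) ⟩
      ½ * ε + ½ * ε
        ≡⟨ halves ε ⟩
      ε ∎
      where
      open ℚ.≤-Reasoning
      M≤m = ℕ.m⊔n≤o⇒m≤o M (J ℕ.⊔ N′) m≥
      M≤n = ℕ.m⊔n≤o⇒m≤o M (J ℕ.⊔ N′) n≥
      J≤m = ℕ.m⊔n≤o⇒m≤o J N′ (ℕ.m⊔n≤o⇒n≤o M (J ℕ.⊔ N′) m≥)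
      J≤n = ℕ.m⊔n≤o⇒m≤o J N′ (ℕ.m⊔n≤o⇒n≤o M (J ℕ.⊔ N′) n≥)
      N≤m = ℕ.m⊔n≤o⇒n≤o J N′ (ℕ.m⊔n≤o⇒n≤o M (J ℕ.⊔ N′) m≥)
      N≤n = ℕ.m⊔n≤o⇒n≤o J N′ (ℕ.m⊔n≤o⇒n≤o M (J ℕ.⊔ N′) n≥)

  diagonal : ℝ
  diagonal = mkℝ diagonalSeq diagonal-cauchy

  diagonal-limit : ∀ ε → 0ℚ < ε → Eventually λ n →
    diagonal -ℝ fromℚ ε ≤ℝ y n × y n ≤ℝ diagonal +ℝ fromℚ ε
  diagonal-limit ε 0<ε with e→0 ε 0<ε
  ... | M , e≤ = M , λ n M≤n →
    (λ ε′ 0<ε′ → n ℕ.⊔ J , λ j j≥ →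
      let n≤j = ℕ.m⊔n≤o⇒m≤o n J j≥ ; J≤j = ℕ.m⊔n≤o⇒n≤o n J j≥
          up = proj₂ (bracket j J≤j n (g j) (ℕ.≤-trans n≤j (n≤gn j)))
      in ℚ.≤-trans (ℚ.+-monoˡ-≤ (- ε) (ℚ.≤-trans up (ℚ.+-monoʳ-≤ (seq (y n) j) (e≤ n M≤n))))
           (≤-by-gap ε′ (ℚ.<⇒≤ 0<ε′) (cong (_+ ε′) (cancel (seq (y n) j) ε)))) ,
    (λ ε′ 0<ε′ → n ℕ.⊔ J , λ j j≥ →
      let n≤j = ℕ.m⊔n≤o⇒m≤o n J j≥ ; J≤j = ℕ.m⊔n≤o⇒n≤o n J j≥
          down = proj₁ (bracket j J≤j n (g j) (ℕ.≤-trans n≤j (n≤gn j)))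
      in ℚ.≤-trans down (≤-by-gap (ε + ε′) (ℚ.<⇒≤ (ℚ.+-mono-< 0<ε 0<ε′)) (ℚ.+-assoc (diagonalSeq j) ε ε′)))
    where
    cancel : ∀ a b → a ≡ a + b - b
    cancel = solve-∀ ring

-- Real series

¼ : ℚ
¼ = ℤ.+ 1 ℚ./ 4

0≤¼ : 0ℚ ≤ ¼
0≤¼ = ℚ.<⇒≤ (ℚ.positive⁻¹ ¼)

0≤½ : 0ℚ ≤ ½
0≤½ = ℚ.<⇒≤ (ℚ.positive⁻¹ ½)

iterate-nonNeg : ∀ {x} → 0ℚ ≤ x → ∀ n → 0ℚ ≤ iterate x n
iterate-nonNeg 0≤x zero    = ℚ.≤-refl
iterate-nonNeg 0≤x (suc n) = 0≤+ 0≤x (0≤* (iterate-nonNeg 0≤x n) (iterate-nonNeg 0≤x n))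

≤-iterate : ∀ {x} → 0ℚ ≤ x → ∀ n → x ≤ iterate x (suc n)
≤-iterate 0≤x n = ≤-by-gap _ (0≤* (iterate-nonNeg 0≤x n) (iterate-nonNeg 0≤x n)) refl

square-mono : ∀ {a b} → 0ℚ ≤ a → a ≤ b → a * a ≤ b * b
square-mono {a} {b} 0≤a a≤b = ℚ.≤-trans (*-monoʳ-nonNeg a 0≤a a≤b) (*-monoˡ-nonNeg b (ℚ.≤-trans 0≤a a≤b) a≤b)

iterate-step : ∀ {x} → 0ℚ ≤ x → ∀ n → iterate x n ≤ iterate x (suc n)
iterate-step         0≤x zero    = iterate-nonNeg 0≤x 1
iterate-step {x} 0≤x (suc n) = ℚ.+-monoʳ-≤ x (square-mono (iterate-nonNeg 0≤x n) (iterate-step 0≤x n))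

module _ {x η : ℚ} (0≤x : 0ℚ ≤ x) (0≤η : 0ℚ ≤ η) (x≤ : x ≤ ¼ - η) where

  private
    η≤¼ : η ≤ ¼
    η≤¼ = ≤-by-gap (¼ - η) (ℚ.≤-trans 0≤x x≤) (restore η ¼)
      where
      restore : ∀ η q → q ≡ η + (q - η)
      restore = solve-∀ ring
    0≤1-η : 0ℚ ≤ 1ℚ - η
    0≤1-η = gap (ℚ.≤-trans η≤¼ (≤-by-gap (ℤ.+ 3 ℚ./ 4) (ℚ.<⇒≤ (ℚ.positive⁻¹ (ℤ.+ 3 ℚ./ 4))) refl))

  -- ½ - η is mapped below itself because η² ≤ η.
  iterate-≤ : ∀ n → iterate x n ≤ ½ - η
  iterate-≤ zero    = gap (ℚ.≤-trans η≤¼ (≤-by-gap ¼ 0≤¼ refl))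
  iterate-≤ (suc n) = ℚ.≤-trans
    (ℚ.+-mono-≤ x≤ (square-mono (iterate-nonNeg 0≤x n) (iterate-≤ n)))
    (≤-by-gap (η * (1ℚ - η)) (0≤* 0≤η 0≤1-η) (complete η))
    where
    complete : ∀ η → ½ - η ≡ ¼ - η + (½ - η) * (½ - η) + η * (1ℚ - η)
    complete = solve-∀ ring

  contraction : ℚ
  contraction = (½ - η) + (½ - η)

  -- Successive iterates a, b satisfy b² - a² = (b + a) (b - a) and are at most ½ - η, so each
  -- increment is at most 1 - 2 η times the previous one. The factor `1ℚ` is the K of
  -- `geometric-bracket`.
  iterate-increment : ∀ n → iterate x (suc n) ≤ iterate x n + 1ℚ * pow contraction n
  iterate-increment zero    = begin
    x + 0ℚ * 0ℚ          ≡⟨ trans (cong (x +_) (ℚ.*-zeroˡ 0ℚ)) (ℚ.+-identityʳ x) ⟩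
    x                    ≤⟨ x≤ ⟩
    ¼ - η                ≤⟨ ≤-by-gap η 0≤η (restore η) ⟩
    ¼                    ≤⟨ ≤-by-gap (ℤ.+ 3 ℚ./ 4) (ℚ.<⇒≤ (ℚ.positive⁻¹ (ℤ.+ 3 ℚ./ 4))) refl ⟩
    0ℚ + 1ℚ * 1ℚ         ∎
    where
    open ℚ.≤-Reasoning
    restore : ∀ η → ¼ ≡ ¼ - η + η
    restore = solve-∀ ring
  iterate-increment (suc n) = begin
    x + b * b
      ≡⟨ factor x a b ⟩
    x + a * a + (b + a) * (b - a)
      ≤⟨ ℚ.+-monoʳ-≤ (x + a * a) (ℚ.≤-trans
           (*-monoˡ-nonNeg (b - a) (gap (iterate-step 0≤x n))
             (ℚ.+-mono-≤ (iterate-≤ (suc n)) (iterate-≤ n)))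
           (*-monoʳ-nonNeg contraction 0≤contraction
             (ℚ.≤-trans (ℚ.+-monoˡ-≤ (- a) (iterate-increment n)) (ℚ.≤-reflexive (cancel a (pow contraction n)))))) ⟩
    x + a * a + contraction * pow contraction n
      ≡⟨ cong (x + a * a +_) (sym (ℚ.*-identityˡ _)) ⟩
    x + a * a + 1ℚ * (contraction * pow contraction n) ∎
    where
    open ℚ.≤-Reasoning
    a = iterate x n
    b = iterate x (suc n)
    0≤contraction : 0ℚ ≤ contraction
    0≤contraction = 0≤+ (iterate-≤ 0) (iterate-≤ 0)
    factor : ∀ x a b → x + b * b ≡ x + a * a + (b + a) * (b - a)
    factor = solve-∀ ring
    cancel : ∀ a t → a + 1ℚ * t - a ≡ t
    cancel = solve-∀ ring

iterate-¼ : ∀ n → iterate ¼ n ≤ ½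
iterate-¼ n = iterate-≤ 0≤¼ ℚ.≤-refl (ℚ.≤-refl {¼}) n

4×increment-≤ : ∀ {i i′ e ε} → i′ ≤ i + e → e ≤ ¼ * ε → nat 4 * (i′ - i) ≤ ε
4×increment-≤ {i} {i′} {e} {ε} i′≤ e≤ = begin
  nat 4 * (i′ - i)      ≤⟨ *-monoʳ-nonNeg (nat 4) (nat-nonNeg 4) (ℚ.+-monoˡ-≤ (- i) i′≤) ⟩
  nat 4 * (i + e - i)   ≡⟨ cong (nat 4 *_) (cancel i e) ⟩
  nat 4 * e             ≤⟨ *-monoʳ-nonNeg (nat 4) (nat-nonNeg 4) e≤ ⟩
  nat 4 * (¼ * ε)       ≡⟨ sym (ℚ.*-assoc (nat 4) ¼ ε) ⟩
  1ℚ * ε                ≡⟨ ℚ.*-identityˡ ε ⟩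
  ε                     ∎
  where
  open ℚ.≤-Reasoning
  cancel : ∀ a b → a + b - a ≡ b
  cancel = solve-∀ ring

≤-+-+ : ∀ {p q r} → 0ℚ ≤ q → 0ℚ ≤ r → p ≤ p + q + r
≤-+-+ {p} {q} {r} 0≤q 0≤r = ≤-by-gap (q + r) (0≤+ 0≤q 0≤r) (ℚ.+-assoc p q r)

cellSum-suc : ∀ κ c L x F → cellSum κ c (suc L) x F ≡
  cellSum κ c L x F + ∑ (connectingCells κ c L) (λ C → pow x L * F (componentSizes C))
cellSum-suc κ c L x F = trans (∑-++ term (cellsBelow κ c L) _)
  (cong (cellSum κ c L x F +_) (∑-map (L ,_) term (connectingCells κ c L)))
  where
  term : AnyWord → ℚ
  term τ = pow x (proj₁ τ) * F (sizes τ)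

∈-connectingCells⁻ : ∀ {κ c n} {C : Word n} → C ∈ connectingCells κ c n → IsConnectingCell κ c C
∈-connectingCells⁻ {κ} {c} {n} C∈ = proj₂ (∈-filter⁻ (isConnectingCell? κ c) {xs = allVecs n n} C∈)

-- At z = ¼ the whole series sums to at most 2⁻ᶜ, so there are at most 4ⁿ cells of size n.
cells-¼ : ∀ κ c n → ∑ (connectingCells κ c n) (λ _ → pow ¼ n) ≤ 1ℚ
cells-¼ κ c n = begin
  S₁
    ≡⟨ ∑-cong (connectingCells κ c n) (λ _ → sym (ℚ.*-identityʳ (pow ¼ n))) ⟩
  ∑ (connectingCells κ c n) (λ _ → pow ¼ n * 1ℚ)
    ≤⟨ ≤-by-gap (cellSum κ c n ¼ one) (∑-nonNeg (cellsBelow κ c n) (λ τ → 0≤* (pow-nonNeg 0≤¼ (proj₁ τ)) 0≤1))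
         (trans (cellSum-suc κ c n ¼ one) (ℚ.+-comm (cellSum κ c n ¼ one) _)) ⟩
  cellSum κ c (suc n) ¼ one
    ≤⟨ cellSum≤box κ 0≤¼ c (suc n) (λ _ → 0≤1) ⟩
  box X ¼ c one
    ≡⟨ box-1 X 0≤¼ c ⟩
  pow (weight X ¼) c
    ≤⟨ pow-≤1 (weight-nonNeg X 0≤¼) (ℚ.≤-trans (weight≤iterate κ 0≤¼ (suc n))
         (ℚ.≤-trans (iterate-¼ (suc n)) (≤-by-gap ½ 0≤½ refl))) c ⟩
  1ℚ ∎
  where
  open ℚ.≤-Reasoning
  S₁ = ∑ (connectingCells κ c n) (λ _ → pow ¼ n)
  one : List ℕ → ℚ
  one _ = 1ℚ
  X = cellsBelow κ 1 (suc n)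

cellTerm : ∀ κ c (F : ∀ {n} → Word n → ℕ) n → ℚ → ℚ
cellTerm κ c F n x = ∑ (connectingCells κ c n) (λ C → pow x n * nat (F C))

cellTerm-nonNeg : ∀ κ c (F : ∀ {n} → Word n → ℕ) {x} → 0ℚ ≤ x → ∀ n → 0ℚ ≤ cellTerm κ c F n x
cellTerm-nonNeg κ c F 0≤x n =
  ∑-nonNeg (connectingCells κ c n) λ C → 0≤* (pow-nonNeg 0≤x n) (nat-nonNeg (F C))

-- In xⁿ ≤ ρⁿ ¼ⁿ the factor ¼ⁿ pays for the number of cells of size n, and ρⁿ is left to outweigh
-- the polynomial.
cellTerm-bound : ∀ κ c (F : ∀ {n} → Word n → ℕ) d → (∀ {n} (C : Word n) → F C ℕ.≤ suc n ℕ.^ d) →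
  ∀ {x ρ} → 0ℚ ≤ x → 0ℚ ≤ ρ → x ≤ ρ * ¼ → ∀ n →
  cellTerm κ c F n x ≤ pow (nat (suc n)) d * pow ρ n
cellTerm-bound κ c F d F≤ {x} {ρ} 0≤x 0≤ρ x≤ n = begin
  ∑ Cs (λ C → pow x n * nat (F C))
    ≤⟨ ∑-mono Cs (λ {C} _ → bound C) ⟩
  ∑ Cs (λ _ → B * pow ¼ n)
    ≡⟨ ∑-*ˡ B (λ _ → pow ¼ n) Cs ⟩
  B * ∑ Cs (λ _ → pow ¼ n)
    ≤⟨ *-monoʳ-nonNeg B (0≤* (pow-nonNeg (nat-nonNeg (suc n)) d) (pow-nonNeg 0≤ρ n)) (cells-¼ κ c n) ⟩
  B * 1ℚ
    ≡⟨ ℚ.*-identityʳ B ⟩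
  B ∎
  where
  open ℚ.≤-Reasoning
  Cs = connectingCells κ c n
  B = pow (nat (suc n)) d * pow ρ n
  rotate : ∀ r q p → r * q * p ≡ p * r * q
  rotate = solve-∀ ring
  bound : ∀ C → pow x n * nat (F C) ≤ B * pow ¼ n
  bound C = begin
    pow x n * nat (F C)
      ≤⟨ *-monoʳ-nonNeg (pow x n) (pow-nonNeg 0≤x n)
           (ℚ.≤-trans (nat-mono (F≤ C)) (ℚ.≤-reflexive (nat-^ (suc n) d))) ⟩
    pow x n * pow (nat (suc n)) d
      ≤⟨ *-monoˡ-nonNeg (pow (nat (suc n)) d) (pow-nonNeg (nat-nonNeg (suc n)) d)
           (ℚ.≤-trans (pow-mono 0≤x x≤ n) (ℚ.≤-reflexive (pow-* ρ ¼ n))) ⟩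
    pow ρ n * pow ¼ n * pow (nat (suc n)) d
      ≡⟨ rotate (pow ρ n) (pow ¼ n) (pow (nat (suc n)) d) ⟩
    B * pow ¼ n ∎

seq-^ : ∀ x n j → seq (x ^ℝ n) j ≡ pow (seq x j) n
seq-^ x zero    j = refl
seq-^ x (suc n) j = cong (seq x j *_) (seq-^ x n j)

seq-sumℝ : ∀ {a} {A : Set a} (f : A → ℝ) xs j → seq (sumℝ (List.map f xs)) j ≡ ∑ xs (λ x → seq (f x) j)
seq-sumℝ f []       j = refl
seq-sumℝ f (x ∷ xs) j = cong (seq (f x) j +_) (seq-sumℝ f xs j)

seq-cellSeries : ∀ κ c z (F : ∀ {n} → Word n → ℕ) n j →
  seq (cellSeries κ c z F n) j ≡ cellTerm κ c F n (seq z j)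
seq-cellSeries κ c z F n j = trans (seq-sumℝ (λ C → z ^ℝ n *ℝ fromℕ (F C)) (connectingCells κ c n) j)
  (∑-cong (connectingCells κ c n) λ {C} _ → cong (_* nat (F C)) (seq-^ z n j))

seq-partialSum : ∀ κ c z (F : ∀ {n} → Word n → ℕ) (G : List ℕ → ℚ) →
  (∀ {n} (C : Word n) → IsConnectingCell κ c C → nat (F C) ≡ G (componentSizes C)) →
  ∀ L j → seq (partialSum (cellSeries κ c z F) L) j ≡ cellSum κ c L (seq z j) G
seq-partialSum κ c z F G F≡G zero    j = refl
seq-partialSum κ c z F G F≡G (suc L) j = trans
  (cong₂ _+_ (seq-partialSum κ c z F G F≡G L j)
    (trans (seq-cellSeries κ c z F L j) (∑-cong (connectingCells κ c L) λ {C} C∈ →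
      cong (pow (seq z j) L *_) (F≡G C (∈-connectingCells⁻ C∈)))))
  (sym (cellSum-suc κ c L (seq z j) G))

partialSum-bracket : ∀ {θ} (0≤θ : 0ℚ ≤ θ) (θ<1 : θ < 1ℚ) {K} → 0ℚ ≤ K → (a : ℕ → ℝ) → ∀ j →
  (∀ n → 0ℚ ≤ seq (a n) j) → (∀ n → seq (a n) j ≤ K * pow θ n) →
  Bracketed (λ n → seq (partialSum a n) j) (λ n → K * inv (1ℚ - θ) (gap-< θ<1) * pow θ n)
partialSum-bracket 0≤θ θ<1 0≤K a j 0≤a a≤ = geometric-bracket 0≤θ θ<1 0≤K
  (λ n → seq (partialSum a n) j)
  (λ n → ≤-by-gap (seq (a n) j) (0≤a n) refl)
  (λ n → ℚ.+-monoʳ-≤ (seq (partialSum a n) j) (a≤ n))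

-- Once q has reached γ, the maximum inside `recip` is q itself, so the inequality can be divided by
-- q at each approximation separately.
quotient-≤ : ∀ x p q (0<q : fromℕ 0 <ℝ q) J → (∀ j → J ℕ.≤ j → seq p j ≤ seq q j * seq x j) →
  p /ℝ q [ 0<q ] ≤ℝ x
quotient-≤ x p q (γ , 0<γ , M , γ≤) J p≤qx ε 0<ε = J ℕ.⊔ M , λ j j≥ →
  ℚ.≤-trans (step (seq p j) (seq q j) (seq x j) (p≤qx j (ℕ.m⊔n≤o⇒m≤o J M j≥))
      (subst (_≤ seq q j) (ℚ.+-identityˡ γ) (γ≤ j (ℕ.m⊔n≤o⇒n≤o J M j≥))))
    (≤-by-gap ε (ℚ.<⇒≤ 0<ε) refl)
  where
  open ℚ.≤-Reasoning
  regroup : ∀ q s i → q * s * i ≡ q * i * s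
  regroup = solve-∀ ring
  step : ∀ p q x → p ≤ q * x → γ ≤ q → p * inv (q ⊔ γ) (⊔-pos q 0<γ) ≤ x
  step p q x p≤ γ≤q = begin
    p * i             ≤⟨ *-monoˡ-nonNeg i (ℚ.<⇒≤ (inv-pos (q ⊔ γ) (⊔-pos q 0<γ))) p≤ ⟩
    q * x * i         ≡⟨ cong (λ r → r * x * i) (sym (ℚ.p≥q⇒p⊔q≡p γ≤q)) ⟩
    (q ⊔ γ) * x * i   ≡⟨ regroup (q ⊔ γ) x i ⟩
    (q ⊔ γ) * i * x   ≡⟨ cong (_* x) (*-inv (q ⊔ γ) (⊔-pos q 0<γ)) ⟩
    1ℚ * x            ≡⟨ ℚ.*-identityˡ x ⟩
    x                 ∎
    where i = inv (q ⊔ γ) (⊔-pos q 0<γ)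

product-≤-product : ∀ {a a′ b b′ p p′ q q′} → a ≡ a′ → b ≡ b′ → p ≡ p′ → q ≡ q′ →
  a′ * b′ ≤ p′ * q′ → a * b ≤ p * q
product-≤-product refl refl refl refl ab≤pq = ab≤pq

nat-count-increasing : ∀ a D → Increasing (λ w → nat (count a D w))
nat-count-increasing a D {w} {w′} w≤w′ = nat-mono {count a D w} {count a D w′} (count-mono a D w≤w′)

-- The reals of the theorem and the inequality between them

iterateℝ : ℝ → ℕ → ℝ
iterateℝ z zero    = fromℕ 0
iterateℝ z (suc n) = z +ℝ iterateℝ z n *ℝ iterateℝ z n

seq-iterateℝ : ∀ z n j → seq (iterateℝ z n) j ≡ iterate (seq z j) n
seq-iterateℝ z zero    j = refl
seq-iterateℝ z (suc n) j = cong (λ q → seq z j + q * q) (seq-iterateℝ z n j)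

-- The witnesses of 0 < z and z < ¼ supply δ and η: δ keeps Q away from 0, and η keeps the ratios of
-- all geometric bounds below 1.
module _ (z : ℝ) {δ η : ℚ} (0<δ : 0ℚ < δ) (0<η : 0ℚ < η) (J : ℕ)
         (near : ∀ j → J ℕ.≤ j → δ ≤ seq z j × seq z j ≤ ¼ - η) where

  private
    0≤η : 0ℚ ≤ η
    0≤η = ℚ.<⇒≤ 0<η
    0≤z : ∀ j → J ℕ.≤ j → 0ℚ ≤ seq z j
    0≤z j J≤j = ℚ.≤-trans (ℚ.<⇒≤ 0<δ) (proj₁ (near j J≤j))
    z≤ : ∀ j → J ℕ.≤ j → seq z j ≤ ¼ - η
    z≤ j J≤j = proj₂ (near j J≤j)
    0≤½-η : 0ℚ ≤ ½ - η
    0≤½-η = iterate-≤ (0≤z J ℕ.≤-refl) 0≤η (z≤ J ℕ.≤-refl) 0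
    4ℚ : ℚ
    4ℚ = ℤ.+ 4 ℚ./ 1
    -- ρ = 1 - 4 η is the ratio of ¼ - η to ¼, as `cellTerm-bound` requires.
    ρ : ℚ
    ρ = 4ℚ * (¼ - η)
    0≤ρ : 0ℚ ≤ ρ
    0≤ρ = 0≤* (nat-nonNeg 4) (ℚ.≤-trans (0≤z J ℕ.≤-refl) (z≤ J ℕ.≤-refl))
    ρ<1 : ρ < 1ℚ
    ρ<1 = subst₂ _<_ (ℚ.+-identityʳ ρ) (complete η) (ℚ.+-monoʳ-< ρ (*-pos 4ℚ η (ℚ.positive⁻¹ 4ℚ) 0<η))
      where
      complete : ∀ η → 4ℚ * (¼ - η) + 4ℚ * η ≡ 1ℚ
      complete = solve-∀ ring
    z≤ρ¼ : ∀ j → J ℕ.≤ j → seq z j ≤ ρ * ¼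
    z≤ρ¼ j J≤j = ℚ.≤-trans (z≤ j J≤j) (ℚ.≤-reflexive (scale η))
      where
      scale : ∀ η → ¼ - η ≡ 4ℚ * (¼ - η) * ¼
      scale = solve-∀ ring

  module _ (κ : Class) (c : ℕ) (F : ∀ {n} → Word n → ℕ) (d : ℕ)
           (F≤ : ∀ {n} (C : Word n) → F C ℕ.≤ suc n ℕ.^ d) where

    cellSeries-bracket : ∃[ e ] Vanishing e ×
      (∀ j → J ℕ.≤ j → Bracketed (λ n → seq (partialSum (cellSeries κ c z F) n) j) e)
    cellSeries-bracket = let K , θ , 0≤K , 0≤θ , θ<1 , bound = polynomial×geometric d 0≤ρ ρ<1 in
      (λ n → K * inv (1ℚ - θ) (gap-< θ<1) * pow θ n) ,
      geometric-vanishing 0≤θ θ<1 (K * inv (1ℚ - θ) (gap-< θ<1)) ,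
      λ j J≤j → partialSum-bracket 0≤θ θ<1 0≤K (cellSeries κ c z F) j
        (λ n → subst (0ℚ ≤_) (sym (seq-cellSeries κ c z F n j))
          (cellTerm-nonNeg κ c F (0≤z j J≤j) n))
        (λ n → subst (_≤ K * pow θ n) (sym (seq-cellSeries κ c z F n j))
          (ℚ.≤-trans (cellTerm-bound κ c F d F≤ (0≤z j J≤j) 0≤ρ (z≤ρ¼ j J≤j) n) (bound n)))

    abstract
      -- Besides the sum S its approximations are exposed, because the final inequality is checked
      -- at each of them.
      seriesSum : (g : ℕ → ℕ) → (∀ n → n ℕ.≤ g n) → ∃[ S ] HasSum (cellSeries κ c z F) S ×
        (∀ j → seq S j ≡ seq (partialSum (cellSeries κ c z F) (g j)) j)
      seriesSum g n≤gn = let e , e→0 , bracket = cellSeries-bracket in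
        diagonal (partialSum (cellSeries κ c z F)) e e→0 J bracket g n≤gn ,
        diagonal-limit (partialSum (cellSeries κ c z F)) e e→0 J bracket g n≤gn ,
        λ j → refl

  private
    θ : ℚ
    θ = (½ - η) + (½ - η)
    0≤θ : 0ℚ ≤ θ
    0≤θ = 0≤+ 0≤½-η 0≤½-η
    θ<1 : θ < 1ℚ
    θ<1 = subst₂ _<_ (ℚ.+-identityʳ θ) (complete η) (ℚ.+-monoʳ-< θ (ℚ.+-mono-< 0<η 0<η))
      where
      complete : ∀ η → (½ - η) + (½ - η) + (η + η) ≡ 1ℚ
      complete = solve-∀ ring
    e : ℕ → ℚ
    e n = 1ℚ * inv (1ℚ - θ) (gap-< θ<1) * pow θ n
    e→0 : Vanishing e
    e→0 = geometric-vanishing 0≤θ θ<1 (1ℚ * inv (1ℚ - θ) (gap-< θ<1))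

  iterate-bracket : ∀ j → J ℕ.≤ j → Bracketed (iterate (seq z j)) e
  iterate-bracket j J≤j = geometric-bracket 0≤θ θ<1 0≤1 (iterate (seq z j))
    (iterate-step (0≤z j J≤j)) (iterate-increment (0≤z j J≤j) 0≤η (z≤ j J≤j))

  fixedPoint : ℝ
  fixedPoint = diagonal (iterateℝ z) e e→0 J
    (λ j J≤j n m n≤m → subst₂ (λ a b → a ≤ b × b ≤ a + e n)
      (sym (seq-iterateℝ z n j)) (sym (seq-iterateℝ z m j)) (iterate-bracket j J≤j n m n≤m))
    id (λ _ → ℕ.≤-refl)

  -- The square root is built from the fixed point, so that ½ (1 - root) has exactly the j-th
  -- iterate as its j-th approximation, the quantity that occurs in `correlation`.
  root : ℝ
  root = fromℕ 1 -ℝ fromℕ 2 *ℝ fixedPoint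

  seq-root : ∀ j → seq root j ≡ 1ℚ - nat 2 * iterate (seq z j) j
  seq-root j = cong (λ q → 1ℚ - nat 2 * q) (seq-iterateℝ z j j)

  -- With i the j-th iterate and i′ = z + i² the next one, (1 - 2 i)² = 1 - 4 z + 4 (i′ - i).
  root-isSqrt : root IsSqrtOf (fromℕ 1 -ℝ fromℕ 4 *ℝ z)
  root-isSqrt = nonNeg , upper , lower
    where
    square : ∀ j → seq (root *ℝ root) j ≡
      1ℚ - nat 4 * seq z j + nat 4 * (iterate (seq z j) (suc j) - iterate (seq z j) j)
    square j = trans (cong (λ s → s * s) (seq-root j)) (expand (seq z j) (iterate (seq z j) j))
      where
      expand : ∀ x i → (1ℚ - nat 2 * i) * (1ℚ - nat 2 * i) ≡ 1ℚ - nat 4 * x + nat 4 * (x + i * i - i)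
      expand = solve-∀ ring
    nonNeg : fromℕ 0 ≤ℝ root
    nonNeg ε 0<ε = J , λ j J≤j → 0≤+ (subst (0ℚ ≤_) (sym (seq-root j))
      (subst (0ℚ ≤_) (double (iterate (seq z j) j))
        (0≤* (nat-nonNeg 2) (gap (ℚ.≤-trans (iterate-≤ (0≤z j J≤j) 0≤η (z≤ j J≤j) j)
          (≤-by-gap η 0≤η (restore η)))))))
      (ℚ.<⇒≤ 0<ε)
      where
      double : ∀ i → nat 2 * (½ - i) ≡ 1ℚ - nat 2 * i
      double = solve-∀ ring
      restore : ∀ η → ½ ≡ ½ - η + η
      restore = solve-∀ ring
    upper : root *ℝ root ≤ℝ fromℕ 1 -ℝ fromℕ 4 *ℝ z
    upper ε 0<ε = let M , e≤ = e→0 (¼ * ε) (*-pos ¼ ε (ℚ.positive⁻¹ ¼) 0<ε) in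
      J ℕ.⊔ M , λ j j≥ → let J≤j = ℕ.m⊔n≤o⇒m≤o J M j≥ ; M≤j = ℕ.m⊔n≤o⇒n≤o J M j≥ in
      subst (_≤ 1ℚ - nat 4 * seq z j + ε) (sym (square j))
        (ℚ.+-monoʳ-≤ (1ℚ - nat 4 * seq z j)
          (4×increment-≤ (proj₂ (iterate-bracket j J≤j j (suc j) (ℕ.n≤1+n j))) (e≤ j M≤j)))
    lower : fromℕ 1 -ℝ fromℕ 4 *ℝ z ≤ℝ root *ℝ root
    lower ε 0<ε = J , λ j J≤j →
      subst (λ s → 1ℚ - nat 4 * seq z j ≤ s + ε) (sym (square j))
        (≤-+-+ (0≤* (nat-nonNeg 4) (gap (iterate-step (0≤z j J≤j) j))) (ℚ.<⇒≤ 0<ε))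

  Q : ℝ
  Q = fromℚ ½ *ℝ (fromℕ 1 -ℝ root)

  seq-Q : ∀ c j → seq (Q ^ℝ c) j ≡ pow (iterate (seq z j) j) c
  seq-Q c j = trans (seq-^ Q c j) (cong (λ q → pow q c)
    (trans (cong (λ s → ½ * (1ℚ - s)) (seq-root j)) (halve (iterate (seq z j) j))))
    where
    halve : ∀ i → ½ * (1ℚ - (1ℚ - nat 2 * i)) ≡ i
    halve = solve-∀ ring

  -- The zeroth iterate is 0, so the lower bound starts at `suc J`: every later iterate is at least
  -- the approximation of z, hence at least δ.
  Qᶜ-pos : ∀ c → fromℕ 0 <ℝ Q ^ℝ c
  Qᶜ-pos c = pow δ c , pow-pos 0<δ c , suc J , λ where
    (suc j) (ℕ.s≤s J≤j) → let J≤1+j = ℕ.m≤n⇒m≤1+n J≤j in subst₂ _≤_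
      (sym (ℚ.+-identityˡ (pow δ c))) (sym (seq-Q c (suc j)))
      (pow-mono (ℚ.<⇒≤ 0<δ) (ℚ.≤-trans (proj₁ (near (suc j) J≤1+j)) (≤-iterate (0≤z (suc j) J≤1+j) j)) c)

  module _ (Dₕ Dᵥ : DominoCell) (κ : Class) (c : ℕ) (1≤c : 1 ℕ.≤ c) where

    private
      dₕ = size Dₕ
      dᵥ = size Dᵥ
      Fₕᵥ : ∀ {n} → Word n → ℕ
      Fₕᵥ C = Nₕ C Dₕ ℕ.* Nᵥ C Dᵥ
      Fₕᵥ≤ : ∀ {n} (C : Word n) → Fₕᵥ C ℕ.≤ suc n ℕ.^ (dₕ ℕ.+ dᵥ)
      Fₕᵥ≤ {n} C = subst (Fₕᵥ C ℕ.≤_) (sym (ℕ.^-distribˡ-+-* (suc n) dₕ dᵥ))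
        (ℕ.*-mono-≤ (N-bound value C Dₕ) (N-bound position C Dᵥ))
      -- The truncation reached by `box≤cellSum`. As c ≥ 1 it is at least j, which the diagonal
      -- requires.
      g : ℕ → ℕ
      g j = suc (c ℕ.* j)
      n≤gn : ∀ n → n ℕ.≤ g n
      n≤gn n = ℕ.m≤n⇒m≤1+n (subst (ℕ._≤ c ℕ.* n) (ℕ.*-identityˡ n) (ℕ.*-monoˡ-≤ n 1≤c))
      Gₕ Gᵥ : List ℕ → ℚ
      Gₕ w = nat (count value Dₕ w)
      Gᵥ w = nat (count position Dᵥ w)
      Fₕ≡ : ∀ {n} (C : Word n) → IsConnectingCell κ c C → nat (Nₕ C Dₕ) ≡ Gₕ (componentSizes C)
      Fₕ≡ C cell = cong nat (N≡count value C Dₕ (sum-sizes κ c (_ , C) cell))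
      Fᵥ≡ : ∀ {n} (C : Word n) → IsConnectingCell κ c C → nat (Nᵥ C Dᵥ) ≡ Gᵥ (componentSizes C)
      Fᵥ≡ C cell = cong nat (N≡count position C Dᵥ (sum-sizes κ c (_ , C) cell))
      Fₕᵥ≡ : ∀ {n} (C : Word n) → IsConnectingCell κ c C →
        nat (Fₕᵥ C) ≡ Gₕ (componentSizes C) * Gᵥ (componentSizes C)
      Fₕᵥ≡ C cell = trans (nat-* (Nₕ C Dₕ) (Nᵥ C Dᵥ)) (cong₂ _*_ (Fₕ≡ C cell) (Fᵥ≡ C cell))

    Sums : Set
    Sums = ∃[ Sₕᵥ ] ∃[ Sₕ ] ∃[ Sᵥ ]
      HasSum (cellSeries κ c z (λ C → Nₕ C Dₕ ℕ.* Nᵥ C Dᵥ)) Sₕᵥ ×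
      HasSum (cellSeries κ c z (λ C → Nₕ C Dₕ)) Sₕ ×
      HasSum (cellSeries κ c z (λ C → Nᵥ C Dᵥ)) Sᵥ ×
      Sₕᵥ ≥ℝ (Sₕ *ℝ Sᵥ) /ℝ Q ^ℝ c [ Qᶜ-pos c ]

    abstract
      seqₕ : ∀ L j → seq (partialSum (cellSeries κ c z (λ C → Nₕ C Dₕ)) L) j ≡
        cellSum κ c L (seq z j) (λ w → nat (count value Dₕ w))
      seqₕ = seq-partialSum κ c z (λ C → Nₕ C Dₕ) Gₕ Fₕ≡

      seqᵥ : ∀ L j → seq (partialSum (cellSeries κ c z (λ C → Nᵥ C Dᵥ)) L) j ≡
        cellSum κ c L (seq z j) (λ w → nat (count position Dᵥ w))
      seqᵥ = seq-partialSum κ c z (λ C → Nᵥ C Dᵥ) Gᵥ Fᵥ≡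

      seqₕᵥ : ∀ L j → seq (partialSum (cellSeries κ c z (λ C → Nₕ C Dₕ ℕ.* Nᵥ C Dᵥ)) L) j ≡
        cellSum κ c L (seq z j) (λ w → nat (count value Dₕ w) * nat (count position Dᵥ w))
      seqₕᵥ = seq-partialSum κ c z (λ C → Nₕ C Dₕ ℕ.* Nᵥ C Dᵥ) (λ w → Gₕ w * Gᵥ w) Fₕᵥ≡

      counts-correlation : ∀ j → J ℕ.≤ j →
        cellSum κ c j (seq z j) (λ w → nat (count value Dₕ w)) *
        cellSum κ c j (seq z j) (λ w → nat (count position Dᵥ w)) ≤
        pow (iterate (seq z j) j) c *
        cellSum κ c (g j) (seq z j) (λ w → nat (count value Dₕ w) * nat (count position Dᵥ w))
      counts-correlation j J≤j = correlation κ (0≤z j J≤j) c j {Gₕ} {Gᵥ}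
        (λ w → nat-nonNeg (count value Dₕ w)) (λ w → nat-nonNeg (count position Dᵥ w))
        (nat-count-increasing value Dₕ) (nat-count-increasing position Dᵥ)

    sums : Sums
    sums =
      let Sₕᵥ , hasSumₕᵥ , sₕᵥ = seriesSum κ c (λ C → Nₕ C Dₕ ℕ.* Nᵥ C Dᵥ) (dₕ ℕ.+ dᵥ) Fₕᵥ≤ g n≤gn
          Sₕ , hasSumₕ , sₕ = seriesSum κ c (λ C → Nₕ C Dₕ) dₕ (λ C → N-bound value C Dₕ) id (λ _ → ℕ.≤-refl)
          Sᵥ , hasSumᵥ , sᵥ = seriesSum κ c (λ C → Nᵥ C Dᵥ) dᵥ (λ C → N-bound position C Dᵥ) id (λ _ → ℕ.≤-refl)
      in Sₕᵥ , Sₕ , Sᵥ , hasSumₕᵥ , hasSumₕ , hasSumᵥ ,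
        -- At index j the single sums are truncated at j, the joint sum at g j, and Q is the j-th
        -- iterate, so the claim is `counts-correlation`.
        quotient-≤ Sₕᵥ (Sₕ *ℝ Sᵥ) (Q ^ℝ c) (Qᶜ-pos c) J λ j J≤j →
          product-≤-product (trans (sₕ j) (seqₕ j j)) (trans (sᵥ j) (seqᵥ j j))
            (seq-Q c j) (trans (sₕᵥ j) (seqₕᵥ (g j) j)) (counts-correlation j J≤j)

theorem3p6 : (z : ℝ) → fromℕ 0 <ℝ z → z <ℝ fromℚ (ℤ.+ 1 ℚ./ 4) →
    (Dₕ Dᵥ : DominoCell) (κ : Class) (c : ℕ) → 1 ℕ.≤ c →
    ∃[ s ] s IsSqrtOf (fromℕ 1 -ℝ fromℕ 4 *ℝ z) ×
    (let Q = fromℚ ½ *ℝ (fromℕ 1 -ℝ s) in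
    Σ[ Qᶜ>0 ∈ fromℕ 0 <ℝ Q ^ℝ c ]
    ∃[ Sₕᵥ ] ∃[ Sₕ ] ∃[ Sᵥ ]
    HasSum (cellSeries κ c z (λ C → Nₕ C Dₕ ℕ.* Nᵥ C Dᵥ)) Sₕᵥ ×
    HasSum (cellSeries κ c z (λ C → Nₕ C Dₕ)) Sₕ ×
    HasSum (cellSeries κ c z (λ C → Nᵥ C Dᵥ)) Sᵥ ×
    Sₕᵥ ≥ℝ (Sₕ *ℝ Sᵥ) /ℝ Q ^ℝ c [ Qᶜ>0 ])
theorem3p6 z (δ , 0<δ , M , δ≤z) (η , 0<η , M′ , z≤¼-η) Dₕ Dᵥ κ c 1≤c =
  root z 0<δ 0<η K near , root-isSqrt z 0<δ 0<η K near , Qᶜ-pos z 0<δ 0<η K near c ,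
  sums z 0<δ 0<η K near Dₕ Dᵥ κ c 1≤c
  where
  K = M ℕ.⊔ M′
  cancel : ∀ a b → a ≡ a + b - b
  cancel = solve-∀ ring
  near : ∀ j → K ℕ.≤ j → δ ≤ seq z j × seq z j ≤ ¼ - η
  near j K≤j = subst (_≤ seq z j) (ℚ.+-identityˡ δ) (δ≤z j (ℕ.m⊔n≤o⇒m≤o M M′ K≤j)) ,
    subst (_≤ ¼ - η) (sym (cancel (seq z j) η)) (ℚ.+-monoˡ-≤ (- η) (z≤¼-η j (ℕ.m⊔n≤o⇒n≤o M M′ K≤j)))
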